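{- For all $n\ge 2$, \[ g_n=\sum_{j=1}^{n-1} b_{n,j}\,(q-1)^{j-1} g_{n-j}, \qquad\text{where}\qquad b_{n,j}=\sum_{k=0}^{n-1-j}\frac{n-1+j-k}{j}\binom{j+k-2}{j-2}\binom{n-2-k}{j-1}q^k . \]
   Context: Let $\mathcal S_n$ be the set of permutations of $\{1,\dots,n\}$. The standard cycle form of $\sigma\in\mathcal S_n$ writes $\sigma$ as a product of disjoint cycles (fixed points included as 1-cycles), each cycle written starting with its smallest letter, and the cycles arranged in increasing order of their smallest letters. $\mathrm{Flatten}(\sigma)$ is the word of length $n$ obtained by erasing the parentheses in the standard cycle form of $\sigma$. An occurrence of the pattern 13-2 in a word $w_1\cdots w_n$ is a pair of indices $(i,j)$ with $2\le i<j\le n$ and $w_{i-1}<w_j<w_i$. Define the polynomial $g_n=\sum_{\pi\in\mathcal S_n} q^{\text{number of occurrences of 13-2 in }\mathrm{Flatten}(\pi)}$ (so $g_1=1$). Binomial coefficients $\binom{a}{b}$ with $b<0$ or $b>a\ge 0$ are $0$; in particular for $j=1$ one uses the convention $\binom{k-1}{ -1}=\chi(k=0)$ (only the $k=0$ term survives with coefficient $\frac{n}{1}\cdot 1$), consistent with $b_{n,1}=n$. -}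

module Defs where

open import Data.Bool using (Bool; true; false; if_then_else_; _∧_; _∨_; not)
open import Data.Nat as ℕ using (ℕ; zero; suc; _∸_; _<ᵇ_; _≡ᵇ_)
open import Data.Nat.Combinatorics using (_C_)
open import Data.Fin using (Fin; toℕ; fromℕ<)
open import Data.Fin.Properties using (_≟_)
open import Data.Vec as Vec using (Vec; []; _∷_; lookup; allFin)
open import Data.List as List using (List; []; _∷_; _++_; map; concatMap; filter; upTo; foldr; length)
open import Data.Integer as ℤ using (ℤ; +_; -[1+_])
open import Data.Rational as ℚ using (ℚ; 0ℚ; 1ℚ; _/_)
open import Relation.Nullary.Decidable using (⌊_⌋)
open import Relation.Binary.PropositionalEquality using (_≡_)

-- Permutations of {1..n}: represented as Vec (Fin n) n, entry i = σ(i)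
-- (letters 0..n-1 stand for 1..n; only relative order matters).

allWords : (n m : ℕ) → List (Vec (Fin m) n)
allWords zero    m = [] ∷ []
allWords (suc n) m =
  concatMap (λ w → map (λ x → x ∷ w) (List.tabulate {n = m} (λ x → x))) (allWords n m)

memB : {m : ℕ} → Fin m → List (Fin m) → Bool
memB x []       = false
memB x (y ∷ ys) = ⌊ x ≟ y ⌋ ∨ memB x ys

distinctB : {m : ℕ} → List (Fin m) → Bool
distinctB []       = true
distinctB (x ∷ xs) = not (memB x xs) ∧ distinctB xs

isPermB : {n : ℕ} → Vec (Fin n) n → Bool
isPermB σ = distinctB (Vec.toList σ)

perms : (n : ℕ) → List (Vec (Fin n) n)
perms n = filter (λ σ → isPermB σ Data.Bool.≟ true) (allWords n n)
  where import Data.Bool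

-- the cycle of σ through i, starting at i: i, σ i, σ² i, ... (fuel n suffices)
cycleOf : {n : ℕ} → Vec (Fin n) n → Fin n → List (Fin n)
cycleOf {n} σ i = i ∷ go n (lookup σ i)
  where
  go : ℕ → Fin n → List (Fin n)
  go zero    x = []
  go (suc k) x = if ⌊ x ≟ i ⌋ then [] else x ∷ go k (lookup σ x)

isCycleMinB : {n : ℕ} → Vec (Fin n) n → Fin n → Bool
isCycleMinB σ i = allB (cycleOf σ i)
  where
  allB : List (Fin _) → Bool
  allB []       = true
  allB (x ∷ xs) = not (toℕ x <ᵇ toℕ i) ∧ allB xs

-- Flatten(σ): cycles written from their smallest letter, cycles in
-- increasing order of smallest letters, parentheses erased.
flatten : {n : ℕ} → Vec (Fin n) n → List ℕ
flatten {n} σ =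
  concatMap (λ i → if isCycleMinB σ i then map toℕ (cycleOf σ i) else [])
            (List.tabulate {n = n} (λ i → i))

-- Occurrences of the pattern 13-2 in a word w₁⋯w_n:
-- pairs (i,j), 2 ≤ i < j ≤ n, with w_{i-1} < w_j < w_i.

countBetween : ℕ → ℕ → List ℕ → ℕ
countBetween a b []       = 0
countBetween a b (c ∷ cs) =
  (if (a <ᵇ c) ∧ (c <ᵇ b) then 1 else 0) ℕ.+ countBetween a b cs

occ13-2 : List ℕ → ℕ
occ13-2 (a ∷ b ∷ rest) = countBetween a b rest ℕ.+ occ13-2 (b ∷ rest)
occ13-2 _              = 0

-- Polynomials in q with rational coefficients, as coefficient lists
-- (constant term first).  Equality is coefficientwise.

Poly : Set
Poly = List ℚ

coeff : Poly → ℕ → ℚ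
coeff []       _       = 0ℚ
coeff (c ∷ cs) zero    = c
coeff (c ∷ cs) (suc i) = coeff cs i

_≈P_ : Poly → Poly → Set
p ≈P r = (i : ℕ) → coeff p i ≡ coeff r i

infix 4 _≈P_
infixl 6 _+P_
infixl 7 _*P_ _·P_

_+P_ : Poly → Poly → Poly
[]       +P r        = r
(c ∷ cs) +P []       = c ∷ cs
(c ∷ cs) +P (d ∷ ds) = (c ℚ.+ d) ∷ (cs +P ds)

_·P_ : ℚ → Poly → Poly
a ·P p = map (a ℚ.*_) p

_*P_ : Poly → Poly → Poly
[]       *P r = []
(c ∷ cs) *P r = (c ·P r) +P (0ℚ ∷ (cs *P r))

0P 1P qP : Poly
0P = []
1P = 1ℚ ∷ []
qP = 0ℚ ∷ 1ℚ ∷ []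

qm1 : Poly
qm1 = ℚ.- 1ℚ ∷ 1ℚ ∷ []

_^P_ : Poly → ℕ → Poly
p ^P zero  = 1P
p ^P suc k = p *P (p ^P k)

qpow : ℕ → Poly
qpow k = qP ^P k

sumP : List Poly → Poly
sumP = foldr _+P_ 0P

g : ℕ → Poly
g n = sumP (map (λ σ → qpow (occ13-2 (flatten σ))) (perms n))

-- Binomial coefficients with integer arguments, following the stated
-- convention: C(a,b) = usual for a,b ≥ 0 (0 if b > a); 0 if b < 0,
-- except C(-1,-1) = 1 (so C(k-1,-1) = χ(k = 0)); 0 if a < 0 ≤ b.
binomℤ : ℤ → ℤ → ℕ
binomℤ (+ a)      (+ b)      = a C b
binomℤ -[1+ 0 ]   -[1+ 0 ]   = 1
binomℤ _          _          = 0

_⊖_ : ℕ → ℕ → ℤ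
a ⊖ b = (+ a) ℤ.- (+ b)

b : (n j' : ℕ) → Poly
b n j' = sumP (map term (upTo (suc (n ∸ 1 ∸ j))))
  where
  j = suc j'
  term : ℕ → Poly
  term k = ((((n ∸ 1) ℕ.+ j) ⊖ k) / j) ·P
             (((+ (binomℤ ((j ℕ.+ k) ⊖ 2) (j ⊖ 2)
                        ℕ.* binomℤ (n ⊖ (2 ℕ.+ k)) (j ⊖ 1))) / 1) ·P qpow k)

rhs : ℕ → Poly
rhs n = sumP (map (λ j' → b n j' *P (qm1 ^P j') *P g (n ∸ suc j')) (upTo (n ∸ 1)))

module Submission where

-- Write the letters of Flatten(σ) one at a time.  If m letters remain, r of them below the last one
-- written, then choosing the i-th remaining letter adds max(i - r, 0) occurrences of 13-2, and i = 0 arises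
-- twice: the least remaining letter either continues the current cycle or opens the next one.  So
-- g_{m+1} = F(m,0), where F(m+1,r) = F(m,0) + Σ_{i≤m} q^{max(i-r,0)} F(m,i).
-- Let T_k be the coefficients of 1/((1-z)^{k+1} (1-qz)^k) and
-- G(k,m) = T_k(m) F(m,0) + Σ_{i≤m} q^i T_k(m-i) F(m,i).  Then F(m+1,0) = G(0,m), and interchanging the two
-- sums in G gives G(k,m) = (T_k(m) + Σ_{i≤m} T_k(i)) F(m,0) + (q-1) G(k+1,m-1).  Unrolling this, with T_k
-- expanded into binomial coefficients, is the recurrence for g.

-- Interchanging the sums in `G` gives F(m-1,p) the weight Σ_r q^{max(r,p)} T_k(m-r). This is q^p
-- times the sum of two parts: Σ_i T_k(i), which does not involve p and so collects into F(m,0), and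
-- (q-1) T_{k+1}(m-1-p), which has the shape of `G` again with k+1 for k. Hence the family `G`
-- closes up. Both the factor q-1 and the passage from T_k to T_{k+1} come from q/(1-qz) = 1/(1-z) +
-- (q-1)/((1-z)(1-qz)). The combinatorial half must match a filter over all words with a tree of
-- successive choices. A partly revealed permutation is represented by a full permutation `τ` that
-- provisionally closes the open cycle and fixes every letter not yet written; appending a letter to
-- the cycle composes `τ` with a transposition.

open import Defs
open import Algebra.Bundles using (CommutativeRing; CommutativeSemiring)
open import Algebra.Structures.Biased using (IsCommutativeSemiringˡ)
open import Data.Bool using (Bool; true; false; if_then_else_; not; _∧_)
import Data.Bool.Properties as Bool
open import Data.Fin as Fin using (Fin; zero; suc; toℕ)
open import Data.Fin.Permutation using (Permutation′; _⟨$⟩ʳ_; _⟨$⟩ˡ_; inverseˡ; inverseʳ; _∘ₚ_; transpose)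
import Data.Fin.Permutation as Perm
import Data.Fin.Properties as Fin
open import Data.Integer as ℤ using (+_)
import Data.Integer.Properties as ℤ
open import Data.List as List using (List; []; _∷_; _++_; map; concatMap; foldr; length; upTo; applyUpTo; cartesianProductWith)
import Data.List.Membership.Propositional as List
import Data.List.Membership.Propositional.Properties as List
open import Data.List.Properties using (map-++; map-upTo)
import Data.List.Relation.Binary.Permutation.Propositional as ↭
open ↭ using (_↭_)
import Data.List.Relation.Binary.Permutation.Propositional.Properties as ↭
open import Data.List.Relation.Unary.All as All using (All; []; _∷_)
open import Data.List.Relation.Unary.AllPairs using ([]; _∷_)
open import Data.List.Relation.Unary.Any using (here; there)
import Data.List.Relation.Unary.Unique.Propositional as List
import Data.List.Relation.Unary.Unique.Propositional.Properties as Unique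
open import Data.Nat as ℕ using (ℕ; zero; suc; _∸_; _≤_; _<ᵇ_; s≤s; z≤n)
open import Data.Nat.Combinatorics using (_C_; nCn≡1; nCk+nC[k+1]≡[n+1]C[k+1])
import Data.Nat.Properties as ℕ
import Data.Nat.Tactic.RingSolver as ℕSolver
open import Data.Product using (∃; _×_; _,_; proj₁; proj₂)
open import Data.Rational as ℚ using (1ℚ; _/_)
import Data.Rational.Properties as ℚ
open import Data.Rational.Unnormalised as ℚᵘ using (mkℚᵘ; *≡*; _≃_)
import Data.Rational.Unnormalised.Properties as ℚᵘ
open import Data.Sum using (_⊎_; inj₁; inj₂)
open import Data.Vec as Vec using (Vec; []; _∷_; lookup; removeAt; tabulate; toList)
import Data.Vec.Membership.DecPropositional as VDec
open import Data.Vec.Membership.Propositional using (_∈_; _∉_)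
open import Data.Vec.Membership.Propositional.Properties using (∈-lookup)
import Data.Vec.Properties as Vec
open import Data.Vec.Relation.Unary.All as VAll using ([]; _∷_)
import Data.Vec.Relation.Unary.All.Properties as VAll
open import Data.Vec.Relation.Unary.AllPairs using (AllPairs; []; _∷_)
open import Data.Vec.Relation.Unary.Any as VAny using (here; there)
import Data.Vec.Relation.Unary.Any.Properties as VAny
import Data.Vec.Relation.Unary.Unique.Propositional as Vec
import Data.Vec.Relation.Unary.Unique.Propositional.Properties as VUnique
open import Function using (_∘_)
open import Level using (0ℓ)
open import Relation.Binary.PropositionalEquality as ≡ using (_≡_; _≢_; cong; cong₂)
import Relation.Binary.Reasoning.Setoid as SetoidReasoning
open import Relation.Binary.Structures using (IsEquivalence)
open import Relation.Nullary using (Dec; yes; no; ¬_; does; contradiction; ¬?)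
open import Relation.Nullary.Decidable using (⌊_⌋; dec-true; dec-false; _→-dec_)
open import Tactic.Cong using (cong!)

-- Power series, and polynomials as a commutative semiring

module Convolution {c ℓ} (S : CommutativeSemiring c ℓ) where
  open CommutativeSemiring S hiding (zero)
  open import Algebra.Solver.Ring.NaturalCoefficients.Default S using (solve; _:+_; _:*_; _:=_)
  open SetoidReasoning setoid

  infixl 7 _⊛_

  -- The Cauchy product, used at two levels: over `ℚ`, where the index is the power of q and
  -- `coeff-*` identifies it with `_*P_`, and over the semiring containing q, where the index is the
  -- power of z.
  _⊛_ : (ℕ → Carrier) → (ℕ → Carrier) → ℕ → Carrier
  (v ⊛ u) zero    = v 0 * u 0
  (v ⊛ u) (suc d) = v 0 * u (suc d) + (v ∘ suc ⊛ u) d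

  ⊛-cong : ∀ {v v′ u u′ : ℕ → Carrier} → (∀ i → v i ≈ v′ i) → (∀ i → u i ≈ u′ i) → ∀ d → (v ⊛ u) d ≈ (v′ ⊛ u′) d
  ⊛-cong p r zero    = *-cong (p 0) (r 0)
  ⊛-cong p r (suc d) = +-cong (*-cong (p 0) (r (suc d))) (⊛-cong (p ∘ suc) r d)

  ⊛-distribʳ : ∀ u v w d → ((λ i → v i + w i) ⊛ u) d ≈ (v ⊛ u) d + (w ⊛ u) d
  ⊛-distribʳ u v w zero    = distribʳ (u 0) (v 0) (w 0)
  ⊛-distribʳ u v w (suc d) = begin
    (v 0 + w 0) * u (suc d) + ((λ i → v (suc i) + w (suc i)) ⊛ u) d      ≈⟨ +-congˡ (⊛-distribʳ u (v ∘ suc) (w ∘ suc) d) ⟩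
    (v 0 + w 0) * u (suc d) + ((v ∘ suc ⊛ u) d + (w ∘ suc ⊛ u) d)
      ≈⟨ solve 5 (λ a b x y z → (a :+ b) :* x :+ (y :+ z) := (a :* x :+ y) :+ (b :* x :+ z)) refl (v 0) (w 0) (u (suc d)) _ _ ⟩
    (v 0 * u (suc d) + (v ∘ suc ⊛ u) d) + (w 0 * u (suc d) + (w ∘ suc ⊛ u) d) ∎

  ⊛-scaleˡ : ∀ a u v d → ((λ i → a * v i) ⊛ u) d ≈ a * (v ⊛ u) d
  ⊛-scaleˡ a u v zero    = *-assoc a (v 0) (u 0)
  ⊛-scaleˡ a u v (suc d) = begin
    a * v 0 * u (suc d) + ((λ i → a * v (suc i)) ⊛ u) d ≈⟨ +-cong (*-assoc a _ _) (⊛-scaleˡ a u (v ∘ suc) d) ⟩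
    a * (v 0 * u (suc d)) + a * (v ∘ suc ⊛ u) d         ≈⟨ distribˡ a _ _ ⟨
    a * (v 0 * u (suc d) + (v ∘ suc ⊛ u) d)             ∎

  ⊛-zeroˡ : ∀ u d → ((λ _ → 0#) ⊛ u) d ≈ 0#
  ⊛-zeroˡ u zero    = zeroˡ _
  ⊛-zeroˡ u (suc d) = trans (+-cong (zeroˡ _) (⊛-zeroˡ u d)) (+-identityˡ 0#)

  -- The recursion of `_⊛_` peels off the term with `v 0`; commutativity needs the other end, the
  -- term with `u 0`.
  ⊛-suc : ∀ v u d → (v ⊛ u) (suc d) ≈ (v ⊛ u ∘ suc) d + v (suc d) * u 0
  ⊛-suc v u zero    = refl
  ⊛-suc v u (suc d) = begin
    v 0 * u (suc (suc d)) + (v ∘ suc ⊛ u) (suc d)                           ≈⟨ +-congˡ (⊛-suc (v ∘ suc) u d) ⟩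
    v 0 * u (suc (suc d)) + ((v ∘ suc ⊛ u ∘ suc) d + v (suc (suc d)) * u 0) ≈⟨ +-assoc _ _ _ ⟨
    v 0 * u (suc (suc d)) + (v ∘ suc ⊛ u ∘ suc) d + v (suc (suc d)) * u 0   ∎

  ⊛-comm : ∀ v u d → (v ⊛ u) d ≈ (u ⊛ v) d
  ⊛-comm v u zero    = *-comm _ _
  ⊛-comm v u (suc d) = begin
    v 0 * u (suc d) + (v ∘ suc ⊛ u) d ≈⟨ +-cong (*-comm _ _) (⊛-comm (v ∘ suc) u d) ⟩
    u (suc d) * v 0 + (u ⊛ v ∘ suc) d ≈⟨ +-comm _ _ ⟩
    (u ⊛ v ∘ suc) d + u (suc d) * v 0 ≈⟨ ⊛-suc u v d ⟨
    (u ⊛ v) (suc d)                   ∎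

  ⊛-assoc : ∀ v u w d → (v ⊛ u ⊛ w) d ≈ (v ⊛ (u ⊛ w)) d
  ⊛-assoc v u w zero    = *-assoc _ _ _
  ⊛-assoc v u w (suc d) = begin
    v 0 * u 0 * w (suc d) + ((λ i → v 0 * u (suc i) + (v ∘ suc ⊛ u) i) ⊛ w) d
      ≈⟨ +-congˡ (⊛-distribʳ w (λ i → v 0 * u (suc i)) (v ∘ suc ⊛ u) d) ⟩
    v 0 * u 0 * w (suc d) + (((λ i → v 0 * u (suc i)) ⊛ w) d + (v ∘ suc ⊛ u ⊛ w) d)
      ≈⟨ +-congˡ (+-cong (⊛-scaleˡ (v 0) w (u ∘ suc) d) (⊛-assoc (v ∘ suc) u w d)) ⟩
    v 0 * u 0 * w (suc d) + (v 0 * (u ∘ suc ⊛ w) d + (v ∘ suc ⊛ (u ⊛ w)) d)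
      ≈⟨ solve 5 (λ a b x y z → a :* b :* x :+ (a :* y :+ z) := a :* (b :* x :+ y) :+ z) refl (v 0) (u 0) (w (suc d)) _ _ ⟩
    v 0 * (u 0 * w (suc d) + (u ∘ suc ⊛ w) d) + (v ∘ suc ⊛ (u ⊛ w)) d ∎

  -- A fold over `applyUpTo`, so that `map-upTo` turns the sums over `upTo` in `b` and `rhs` into
  -- this form.
  Σ< : (ℕ → Carrier) → ℕ → Carrier
  Σ< f n = foldr _+_ 0# (applyUpTo f n)

  Σ<-cong : ∀ n {f h : ℕ → Carrier} → (∀ i → i ℕ.< n → f i ≈ h i) → Σ< f n ≈ Σ< h n
  Σ<-cong zero    p = refl
  Σ<-cong (suc n) p = +-cong (p 0 ℕ.z<s) (Σ<-cong n (λ i i<n → p (suc i) (ℕ.s<s i<n)))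

  Σ<-* : ∀ n a f → a * Σ< f n ≈ Σ< (λ i → a * f i) n
  Σ<-* zero    a f = zeroʳ a
  Σ<-* (suc n) a f = trans (distribˡ a _ _) (+-congˡ (Σ<-* n a (f ∘ suc)))

  ⊛-Σ< : ∀ v u d → (v ⊛ u) d ≈ Σ< (λ i → v i * u (d ∸ i)) (suc d)
  ⊛-Σ< v u zero    = sym (+-identityʳ _)
  ⊛-Σ< v u (suc d) = +-congˡ (⊛-Σ< (v ∘ suc) u d)

module ℚC = Convolution (CommutativeRing.commutativeSemiring ℚ.+-*-commutativeRing)

coeff-+ : ∀ p r i → coeff (p +P r) i ≡ coeff p i ℚ.+ coeff r i
coeff-+ []       r        i       = ≡.sym (ℚ.+-identityˡ _)
coeff-+ (c ∷ cs) []       i       = ≡.sym (ℚ.+-identityʳ _)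
coeff-+ (c ∷ cs) (d ∷ ds) zero    = ≡.refl
coeff-+ (c ∷ cs) (d ∷ ds) (suc i) = coeff-+ cs ds i

coeff-· : ∀ a p i → coeff (a ·P p) i ≡ a ℚ.* coeff p i
coeff-· a []       i       = ≡.sym (ℚ.*-zeroʳ a)
coeff-· a (c ∷ cs) zero    = ≡.refl
coeff-· a (c ∷ cs) (suc i) = coeff-· a cs i

coeff-* : ∀ p r i → coeff (p *P r) i ≡ (coeff p ℚC.⊛ coeff r) i
coeff-* []       r i       = ≡.sym (ℚC.⊛-zeroˡ (coeff r) i)
coeff-* (c ∷ cs) r zero    = ≡.trans (coeff-+ (c ·P r) _ 0) (≡.trans (ℚ.+-identityʳ _) (coeff-· c r 0))
coeff-* (c ∷ cs) r (suc i) = ≡.trans (coeff-+ (c ·P r) _ (suc i)) (cong₂ ℚ._+_ (coeff-· c r (suc i)) (coeff-* cs r i))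

coeff-1P : ∀ u i → (coeff 1P ℚC.⊛ u) i ≡ u i
coeff-1P u zero    = ℚ.*-identityˡ _
coeff-1P u (suc i) = ≡.trans (cong₂ ℚ._+_ (ℚ.*-identityˡ (u (suc i))) (ℚC.⊛-zeroˡ u i)) (ℚ.+-identityʳ _)

infix 4 _≋_

-- A record, so that unification can recover the two polynomials from an equation.
record _≋_ (p r : Poly) : Set where
  constructor coeffwise
  field coeffs : p ≈P r

open _≋_

polySemiring : CommutativeSemiring 0ℓ 0ℓ
polySemiring = record
  { _≈_ = _≋_
  ; _+_ = _+P_
  ; _*_ = _*P_
  ; 0#  = 0P
  ; 1#  = 1P
  ; isCommutativeSemiring = IsCommutativeSemiringˡ.isCommutativeSemiring record
    { +-isCommutativeMonoid = record
      { isMonoid = record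
        { isSemigroup = record
          { isMagma = record
            { isEquivalence = isEquivalence
            ; ∙-cong = λ {p} {p′} {r} {r′} e f → coeffwise λ i → begin
                coeff (p +P r) i          ≡⟨ coeff-+ p r i ⟩
                coeff p i ℚ.+ coeff r i   ≡⟨ cong₂ ℚ._+_ (coeffs e i) (coeffs f i) ⟩
                coeff p′ i ℚ.+ coeff r′ i ≡⟨ coeff-+ p′ r′ i ⟨
                coeff (p′ +P r′) i        ∎
            }
          ; assoc = λ p r s → coeffwise λ i → begin
              coeff (p +P r +P s) i                   ≡⟨ coeff-+ (p +P r) s i ⟩
              coeff (p +P r) i ℚ.+ coeff s i          ≡⟨ cong (ℚ._+ coeff s i) (coeff-+ p r i) ⟩
              coeff p i ℚ.+ coeff r i ℚ.+ coeff s i   ≡⟨ ℚ.+-assoc (coeff p i) _ _ ⟩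
              coeff p i ℚ.+ (coeff r i ℚ.+ coeff s i) ≡⟨ cong (coeff p i ℚ.+_) (coeff-+ r s i) ⟨
              coeff p i ℚ.+ coeff (r +P s) i          ≡⟨ coeff-+ p (r +P s) i ⟨
              coeff (p +P (r +P s)) i                 ∎
          }
        ; identity = (λ p → coeffwise λ i → ≡.refl) , (λ p → coeffwise λ i → ≡.trans (coeff-+ p [] i) (ℚ.+-identityʳ _))
        }
      ; comm = λ p r → coeffwise λ i → ≡.trans (coeff-+ p r i) (≡.trans (ℚ.+-comm (coeff p i) _) (≡.sym (coeff-+ r p i)))
      }
    ; *-isCommutativeMonoid = record
      { isMonoid = record
        { isSemigroup = record
          { isMagma = record
            { isEquivalence = isEquivalence
            ; ∙-cong = λ {p} {p′} {r} {r′} e f → coeffwise λ i → begin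
                coeff (p *P r) i           ≡⟨ coeff-* p r i ⟩
                (coeff p ℚC.⊛ coeff r) i   ≡⟨ ℚC.⊛-cong (coeffs e) (coeffs f) i ⟩
                (coeff p′ ℚC.⊛ coeff r′) i ≡⟨ coeff-* p′ r′ i ⟨
                coeff (p′ *P r′) i         ∎
            }
          ; assoc = λ p r s → coeffwise λ i → begin
              coeff (p *P r *P s) i                   ≡⟨ coeff-* (p *P r) s i ⟩
              (coeff (p *P r) ℚC.⊛ coeff s) i         ≡⟨ ℚC.⊛-cong (coeff-* p r) (λ _ → ≡.refl) i ⟩
              (coeff p ℚC.⊛ coeff r ℚC.⊛ coeff s) i   ≡⟨ ℚC.⊛-assoc (coeff p) (coeff r) (coeff s) i ⟩
              (coeff p ℚC.⊛ (coeff r ℚC.⊛ coeff s)) i ≡⟨ ℚC.⊛-cong {coeff p} (λ _ → ≡.refl) (coeff-* r s) i ⟨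
              (coeff p ℚC.⊛ coeff (r *P s)) i         ≡⟨ coeff-* p (r *P s) i ⟨
              coeff (p *P (r *P s)) i                 ∎
          }
        ; identity = (λ p → coeffwise λ i → ≡.trans (coeff-* 1P p i) (coeff-1P (coeff p) i))
                   , (λ p → coeffwise λ i → ≡.trans (coeff-* p 1P i) (≡.trans (ℚC.⊛-comm (coeff p) (coeff 1P) i) (coeff-1P (coeff p) i)))
        }
      ; comm = λ p r → coeffwise λ i → ≡.trans (coeff-* p r i) (≡.trans (ℚC.⊛-comm (coeff p) (coeff r) i) (≡.sym (coeff-* r p i)))
      }
    ; distribʳ = λ p r s → coeffwise λ i → begin
        coeff ((r +P s) *P p) i                               ≡⟨ coeff-* (r +P s) p i ⟩
        (coeff (r +P s) ℚC.⊛ coeff p) i                       ≡⟨ ℚC.⊛-cong (coeff-+ r s) (λ _ → ≡.refl) i ⟩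
        ((λ j → coeff r j ℚ.+ coeff s j) ℚC.⊛ coeff p) i      ≡⟨ ℚC.⊛-distribʳ (coeff p) (coeff r) (coeff s) i ⟩
        (coeff r ℚC.⊛ coeff p) i ℚ.+ (coeff s ℚC.⊛ coeff p) i ≡⟨ cong₂ ℚ._+_ (coeff-* r p i) (coeff-* s p i) ⟨
        coeff (r *P p) i ℚ.+ coeff (s *P p) i                 ≡⟨ coeff-+ (r *P p) (s *P p) i ⟨
        coeff (r *P p +P s *P p) i                            ∎
    ; zeroˡ = λ p → coeffwise λ i → ≡.refl
    }
  }
  where
  open ≡.≡-Reasoning
  isEquivalence : IsEquivalence _≋_
  isEquivalence = record
    { refl  = coeffwise λ i → ≡.refl
    ; sym   = λ e → coeffwise λ i → ≡.sym (coeffs e i)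
    ; trans = λ e f → coeffwise λ i → ≡.trans (coeffs e i) (coeffs f i)
    }

-- The recurrence in a commutative semiring

paths : ℕ → ℕ → ℕ
paths a d = (a ℕ.+ d) C a

paths-0 : ∀ a → paths a 0 ≡ 1
paths-0 a = ≡.trans (cong (_C a) (ℕ.+-identityʳ a)) (nCn≡1 a)

paths-suc : ∀ a d → paths (suc a) (suc d) ≡ paths (suc a) d ℕ.+ paths a (suc d)
paths-suc a d = begin
  suc (a ℕ.+ suc d) C suc a                 ≡⟨ nCk+nC[k+1]≡[n+1]C[k+1] (a ℕ.+ suc d) a ⟨
  paths a (suc d) ℕ.+ (a ℕ.+ suc d) C suc a ≡⟨ cong (λ n → paths a (suc d) ℕ.+ n C suc a) (ℕ.+-suc a d) ⟩
  paths a (suc d) ℕ.+ paths (suc a) d       ≡⟨ ℕ.+-comm (paths a (suc d)) _ ⟩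
  paths (suc a) d ℕ.+ paths a (suc d)       ∎
  where open ≡.≡-Reasoning

mutual
  -- Chained at (a,d), the two absorption identities give (d+1) C(a+d+1,a) = (a+1) C(a+d+1,a+1),
  -- which is what each needs after Pascal's rule. So the inductions run together, this one lowering
  -- a and the other lowering d.
  paths-absorbʳ : ∀ a d → suc d ℕ.* paths a (suc d) ≡ (suc a ℕ.+ d) ℕ.* paths a d
  paths-absorbʳ zero    d = ≡.refl
  paths-absorbʳ (suc a) d = begin
    suc d ℕ.* paths (suc a) (suc d)                         ≡⟨ cong (suc d ℕ.*_) (paths-suc a d) ⟩
    suc d ℕ.* (paths (suc a) d ℕ.+ paths a (suc d))         ≡⟨ ℕ.*-distribˡ-+ (suc d) (paths (suc a) d) _ ⟩
    suc d ℕ.* paths (suc a) d ℕ.+ suc d ℕ.* paths a (suc d) ≡⟨ cong (suc d ℕ.* paths (suc a) d ℕ.+_) (≡.trans (paths-absorbʳ a d) (paths-absorbˡ a d)) ⟩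
    suc d ℕ.* paths (suc a) d ℕ.+ suc a ℕ.* paths (suc a) d ≡⟨ ℕ.*-distribʳ-+ (paths (suc a) d) (suc d) (suc a) ⟨
    (suc d ℕ.+ suc a) ℕ.* paths (suc a) d                   ≡⟨ cong (ℕ._* paths (suc a) d) (≡.trans (ℕ.+-comm (suc d) (suc a)) (ℕ.+-suc (suc a) d)) ⟩
    (suc (suc a) ℕ.+ d) ℕ.* paths (suc a) d                 ∎
    where open ≡.≡-Reasoning

  paths-absorbˡ : ∀ a d → (suc a ℕ.+ d) ℕ.* paths a d ≡ suc a ℕ.* paths (suc a) d
  paths-absorbˡ a zero    = cong₂ ℕ._*_ (ℕ.+-identityʳ (suc a)) (≡.trans (paths-0 a) (≡.sym (paths-0 (suc a))))
  paths-absorbˡ a (suc d) = begin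
    (suc a ℕ.+ suc d) ℕ.* paths a (suc d)                   ≡⟨ ℕ.*-distribʳ-+ (paths a (suc d)) (suc a) (suc d) ⟩
    suc a ℕ.* paths a (suc d) ℕ.+ suc d ℕ.* paths a (suc d) ≡⟨ cong (suc a ℕ.* paths a (suc d) ℕ.+_) (≡.trans (paths-absorbʳ a d) (paths-absorbˡ a d)) ⟩
    suc a ℕ.* paths a (suc d) ℕ.+ suc a ℕ.* paths (suc a) d ≡⟨ ℕ.+-comm (suc a ℕ.* paths a (suc d)) _ ⟩
    suc a ℕ.* paths (suc a) d ℕ.+ suc a ℕ.* paths a (suc d) ≡⟨ ℕ.*-distribˡ-+ (suc a) (paths (suc a) d) _ ⟨
    suc a ℕ.* (paths (suc a) d ℕ.+ paths a (suc d))         ≡⟨ cong (suc a ℕ.*_) (paths-suc a d) ⟨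
    suc a ℕ.* paths (suc a) (suc d)                         ∎
    where open ≡.≡-Reasoning

-- The coefficient of z^i in 1/(1-z)^k. As k is j-1 here, the separate values at k = 0 are the
-- stated convention for j = 1.
multichoose : ℕ → ℕ → ℕ
multichoose zero    zero    = 1
multichoose zero    (suc i) = 0
multichoose (suc k) i       = paths k i

multichoose-0 : ∀ k → multichoose k 0 ≡ 1
multichoose-0 zero    = ≡.refl
multichoose-0 (suc k) = paths-0 k

multichoose-suc : ∀ k i → multichoose (suc k) (suc i) ≡ multichoose (suc k) i ℕ.+ multichoose k (suc i)
multichoose-suc zero    i = ≡.refl
multichoose-suc (suc k) i = paths-suc k i

-- With n - 1 = k + 1 + d, the integer form of the coefficients of b_{n,k+1}:
-- (n+k-i)/(k+1) C(n-2-i,k) = C(n-2-i,k) + C(n-1-i,k+1).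
coefficient : ℕ → ℕ → ℕ → ℕ
coefficient k d i = multichoose k i ℕ.* (paths k (d ∸ i) ℕ.+ paths (suc k) (d ∸ i))

module Recurrence {c ℓ} (S : CommutativeSemiring c ℓ) where
  open CommutativeSemiring S hiding (zero)
  open Convolution S public
  open import Algebra.Solver.Ring.NaturalCoefficients.Default S using (solve; _:+_; _:*_; _:=_)
  open import Algebra.Properties.Semiring.Exp semiring public using (_^_)
  open import Algebra.Properties.Semiring.Mult semiring public using () renaming (_×_ to _·_)
  open import Algebra.Properties.Semiring.Mult semiring
    using (×-congˡ; ×-congʳ; ×-homo-+; ×-assoc-*; ×-comm-*; ×-assocˡ; ×-homo-1)
  open import Algebra.Properties.Semiring.Sum semiring public
    using (sum⁺-syntax; sum-syntax; ∑-comm; ∑-distrib-+; *-distribˡ-sum; *-distribʳ-sum; sum-cong-≋)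
  open SetoidReasoning setoid

  -- I, and J below, multiply a power series by 1/(1-z) and 1/(1-qz); the series u a is 1/(1-z)^{a+1},
  -- and v k is 1/(1-qz)^k.
  I : (ℕ → Carrier) → ℕ → Carrier
  I t zero    = t 0
  I t (suc d) = I t d + t (suc d)

  I-cong : ∀ {t t′} → (∀ d → t d ≈ t′ d) → ∀ d → I t d ≈ I t′ d
  I-cong p zero    = p 0
  I-cong p (suc d) = +-cong (I-cong p d) (p (suc d))

  I-suc : ∀ t d → I t (suc d) ≈ t 0 + I (t ∘ suc) d
  I-suc t zero    = refl
  I-suc t (suc d) = trans (+-congʳ (I-suc t d)) (+-assoc _ _ _)

  I-linear : ∀ a t u d → I (λ i → a * t i + u i) d ≈ a * I t d + I u d
  I-linear a t u zero    = refl
  I-linear a t u (suc d) = begin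
    I (λ i → a * t i + u i) d + (a * t (suc d) + u (suc d)) ≈⟨ +-congʳ (I-linear a t u d) ⟩
    a * I t d + I u d + (a * t (suc d) + u (suc d))
      ≈⟨ solve 5 (λ a x y z w → a :* x :+ y :+ (a :* z :+ w) := a :* (x :+ z) :+ (y :+ w)) refl a _ _ _ _ ⟩
    a * (I t d + t (suc d)) + (I u d + u (suc d)) ∎

  I-⊛ : ∀ v u d → I (v ⊛ u) d ≈ (v ⊛ I u) d
  I-⊛ v u zero    = refl
  I-⊛ v u (suc d) = begin
    I (v ⊛ u) (suc d)                                         ≈⟨ I-suc (v ⊛ u) d ⟩
    v 0 * u 0 + I (λ i → v 0 * u (suc i) + (v ∘ suc ⊛ u) i) d ≈⟨ +-congˡ (I-linear (v 0) (u ∘ suc) (v ∘ suc ⊛ u) d) ⟩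
    v 0 * u 0 + (v 0 * I (u ∘ suc) d + I (v ∘ suc ⊛ u) d)     ≈⟨ +-assoc _ _ _ ⟨
    v 0 * u 0 + v 0 * I (u ∘ suc) d + I (v ∘ suc ⊛ u) d       ≈⟨ +-cong (sym (distribˡ (v 0) _ _)) (I-⊛ (v ∘ suc) u d) ⟩
    v 0 * (u 0 + I (u ∘ suc) d) + (v ∘ suc ⊛ I u) d           ≈⟨ +-congʳ (*-congˡ (I-suc u d)) ⟨
    v 0 * I u (suc d) + (v ∘ suc ⊛ I u) d                     ∎

  u : ℕ → ℕ → Carrier
  u a d = paths a d · 1#

  I-u : ∀ a d → I (u a) d ≈ u (suc a) d
  I-u a zero    = ×-congˡ (≡.trans (paths-0 a) (≡.sym (paths-0 (suc a))))
  I-u a (suc d) = begin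
    I (u a) d + u a (suc d)                    ≈⟨ +-congʳ (I-u a d) ⟩
    u (suc a) d + u a (suc d)                  ≈⟨ ×-homo-+ 1# (paths (suc a) d) (paths a (suc d)) ⟨
    (paths (suc a) d ℕ.+ paths a (suc d)) · 1# ≈⟨ ×-congˡ (paths-suc a d) ⟨
    u (suc a) (suc d)                          ∎

  headTwice : ℕ → (ℕ → Carrier) → Carrier
  headTwice m h = h 0 + ∑[ i ≤ m ] h (toℕ i)

  headTwice-cong : ∀ m {h h′ : ℕ → Carrier} → (∀ i → i ℕ.≤ m → h i ≈ h′ i) → headTwice m h ≈ headTwice m h′
  headTwice-cong m p = +-cong (p 0 ℕ.z≤n) (sum-cong-≋ λ i → p (toℕ i) (ℕ.s≤s⁻¹ (Fin.toℕ<n i)))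

  headTwice-+ : ∀ m h h′ → headTwice m (λ i → h i + h′ i) ≈ headTwice m h + headTwice m h′
  headTwice-+ m h h′ = begin
    h 0 + h′ 0 + ∑[ i ≤ m ] (h (toℕ i) + h′ (toℕ i)) ≈⟨ +-congˡ (∑-distrib-+ {suc m} (h ∘ toℕ) (h′ ∘ toℕ)) ⟩
    h 0 + h′ 0 + (∑[ i ≤ m ] h (toℕ i) + ∑[ i ≤ m ] h′ (toℕ i))
      ≈⟨ solve 4 (λ a b x y → a :+ b :+ (x :+ y) := a :+ x :+ (b :+ y)) refl (h 0) (h′ 0) _ _ ⟩
    headTwice m h + headTwice m h′ ∎

  headTwice-* : ∀ m a h → headTwice m (λ i → a * h i) ≈ a * headTwice m h
  headTwice-* m a h = trans (+-congˡ (sym (*-distribˡ-sum {suc m} a (h ∘ toℕ)))) (sym (distribˡ a _ _))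

  ∑-headTwice : ∀ n m (h : Fin n → ℕ → Carrier) → ∑[ r < n ] headTwice m (h r) ≈ headTwice m (λ i → ∑[ r < n ] h r i)
  ∑-headTwice n m h = trans (∑-distrib-+ {n} (λ r → h r 0) (λ r → ∑[ i ≤ m ] h r (toℕ i))) (+-congˡ (∑-comm {n} {suc m} (λ r i → h r (toℕ i))))

  -- A semiring has no subtraction, so q-1 enters as an element `s` with q = 1 + s.
  module _ (q s : Carrier) (q≈1+s : q ≈ 1# + s) where

    F : ℕ → ℕ → Carrier
    F zero    r = 1#
    F (suc m) r = headTwice m (λ i → q ^ (i ∸ r) * F m i)

    J : (ℕ → Carrier) → ℕ → Carrier
    J t zero    = t 0
    J t (suc d) = q * J t d + t (suc d)

    J-cong : ∀ {t t′} → (∀ d → t d ≈ t′ d) → ∀ d → J t d ≈ J t′ d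
    J-cong p zero    = p 0
    J-cong p (suc d) = +-cong (*-congˡ (J-cong p d)) (p (suc d))

    J-∑ : ∀ t d → ∑[ r ≤ d ] (q ^ toℕ r * t (d ∸ toℕ r)) ≈ J t d
    J-∑ t zero    = trans (+-identityʳ _) (*-identityˡ _)
    J-∑ t (suc d) = begin
      1# * t (suc d) + ∑[ r ≤ d ] (q * q ^ toℕ r * t (d ∸ toℕ r)) ≈⟨ +-cong (*-identityˡ _) (sum-cong-≋ {suc d} λ r → *-assoc q (q ^ toℕ r) (t (d ∸ toℕ r))) ⟩
      t (suc d) + ∑[ r ≤ d ] (q * (q ^ toℕ r * t (d ∸ toℕ r)))    ≈⟨ +-congˡ (*-distribˡ-sum {suc d} q (λ r → q ^ toℕ r * t (d ∸ toℕ r))) ⟨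
      t (suc d) + q * ∑[ r ≤ d ] (q ^ toℕ r * t (d ∸ toℕ r))      ≈⟨ +-congˡ (*-congˡ (J-∑ t d)) ⟩
      t (suc d) + q * J t d                                       ≈⟨ +-comm _ _ ⟩
      J t (suc d)                                                 ∎

    q* : ∀ x → q * x ≈ x + s * x
    q* x = trans (*-congʳ q≈1+s) (trans (distribʳ x 1# s) (+-congʳ (*-identityˡ x)))

    -- This is q/(1-qz) = 1/(1-z) + (q-1)/((1-z)(1-qz)), multiplied by the series `t`. It is the
    -- source of every factor `s`.
    qJ≈I+sJI : ∀ t d → q * J t d ≈ I t d + s * J (I t) d
    qJ≈I+sJI t zero    = q* (t 0)
    qJ≈I+sJI t (suc d) = begin
      q * (q * J t d + t (suc d))                                 ≈⟨ *-congˡ (+-congʳ (qJ≈I+sJI t d)) ⟩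
      q * (I t d + s * J (I t) d + t (suc d))
        ≈⟨ solve 5 (λ q s i j x → q :* (i :+ s :* j :+ x) := q :* (i :+ x) :+ s :* (q :* j)) refl q s _ _ _ ⟩
      q * (I t d + t (suc d)) + s * (q * J (I t) d)               ≈⟨ +-congʳ (q* (I t (suc d))) ⟩
      I t (suc d) + s * I t (suc d) + s * (q * J (I t) d)
        ≈⟨ solve 4 (λ s i j x → i :+ s :* i :+ s :* x := i :+ s :* (x :+ i)) refl s _ 1# _ ⟩
      I t (suc d) + s * J (I t) (suc d)                           ∎

    -- Σ_r q^{max r p} t_{M-r} with M = p + e + 1, since r + (p ∸ r) = max r p.
    kernel : ∀ t p e →
      ∑[ r ≤ suc (p ℕ.+ e) ] (q ^ toℕ r * t (suc (p ℕ.+ e) ∸ toℕ r) * q ^ (p ∸ toℕ r))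
        ≈ q ^ p * (I t (suc (p ℕ.+ e)) + s * J (I t) e)
    kernel t zero e = begin
      ∑[ r ≤ suc e ] (q ^ toℕ r * t (suc e ∸ toℕ r) * q ^ (0 ∸ toℕ r))
        ≈⟨ sum-cong-≋ {suc (suc e)} (λ r → trans (*-congˡ (reflexive (cong (q ^_) (ℕ.0∸n≡0 (toℕ r))))) (*-identityʳ (q ^ toℕ r * t (suc e ∸ toℕ r)))) ⟩
      ∑[ r ≤ suc e ] (q ^ toℕ r * t (suc e ∸ toℕ r)) ≈⟨ J-∑ t (suc e) ⟩
      q * J t e + t (suc e)                          ≈⟨ +-congʳ (qJ≈I+sJI t e) ⟩
      I t e + s * J (I t) e + t (suc e)
        ≈⟨ solve 3 (λ i j x → i :+ j :+ x := i :+ x :+ j) refl _ _ _ ⟩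
      I t (suc e) + s * J (I t) e        ≈⟨ *-identityˡ _ ⟨
      1# * (I t (suc e) + s * J (I t) e) ∎
    -- The term r = 0 is q^{p+1} t_{M+1}, which completes `I t M` to `I t (suc M)`. Every later term
    -- is q times a term of the sum for p, so the `J` part keeps the same `e`.
    kernel t (suc p) e = begin
      1# * t (suc M) * q ^ suc p + ∑[ r ≤ M ] (q * q ^ toℕ r * t (M ∸ toℕ r) * q ^ (p ∸ toℕ r))
        ≈⟨ +-congˡ (sum-cong-≋ {suc M} λ r → solve 4 (λ a b x y → a :* b :* x :* y := a :* (b :* x :* y)) refl q (q ^ toℕ r) (t (M ∸ toℕ r)) (q ^ (p ∸ toℕ r))) ⟩
      1# * t (suc M) * q ^ suc p + ∑[ r ≤ M ] (q * (q ^ toℕ r * t (M ∸ toℕ r) * q ^ (p ∸ toℕ r)))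
        ≈⟨ +-cong (*-congʳ (*-identityˡ _)) (sym (*-distribˡ-sum {suc M} q (λ r → q ^ toℕ r * t (M ∸ toℕ r) * q ^ (p ∸ toℕ r)))) ⟩
      t (suc M) * q ^ suc p + q * ∑[ r ≤ M ] (q ^ toℕ r * t (M ∸ toℕ r) * q ^ (p ∸ toℕ r))
        ≈⟨ +-congˡ (*-congˡ (kernel t p e)) ⟩
      t (suc M) * (q * q ^ p) + q * (q ^ p * (I t M + s * J (I t) e))
        ≈⟨ solve 5 (λ x q y i j → x :* (q :* y) :+ q :* (y :* (i :+ j)) := q :* y :* (i :+ x :+ j)) refl _ q _ _ _ ⟩
      q ^ suc p * (I t (suc M) + s * J (I t) e) ∎
      where M = suc (p ℕ.+ e)

    kernel′ : ∀ t m p → p ℕ.≤ m →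
      ∑[ r ≤ suc m ] (q ^ toℕ r * t (suc m ∸ toℕ r) * q ^ (p ∸ toℕ r))
        ≈ q ^ p * (I t (suc m) + s * J (I t) (m ∸ p))
    kernel′ t m p p≤m = ≡.subst
      (λ m′ → ∑[ r ≤ suc m′ ] (q ^ toℕ r * t (suc m′ ∸ toℕ r) * q ^ (p ∸ toℕ r)) ≈ q ^ p * (I t (suc m′) + s * J (I t) (m ∸ p)))
      (ℕ.m+[n∸m]≡n p≤m) (kernel t p (m ∸ p))

    T : ℕ → ℕ → Carrier
    T zero    d = 1#
    T (suc k)   = J (I (T k))

    T+IT : ℕ → ℕ → Carrier
    T+IT k d = T k d + I (T k) d

    G : ℕ → ℕ → Carrier
    G k m = headTwice m (λ i → q ^ i * T k (m ∸ i) * F m i)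

    F≈G : ∀ m → F (suc m) 0 ≈ G 0 m
    F≈G m = headTwice-cong m λ i _ → *-congʳ {F m i} (sym (*-identityʳ (q ^ i)))

    G-suc : ∀ k m → G k (suc m) ≈ T+IT k (suc m) * F (suc m) 0 + s * G (suc k) m
    G-suc k m = begin
      1# * t (suc m) * f + ∑[ r ≤ suc m ] (c′ (toℕ r) * headTwice m (λ p → q ^ (p ∸ toℕ r) * F m p))
        ≈⟨ +-cong (*-congʳ (*-identityˡ _)) (sum-cong-≋ {suc (suc m)} λ r → sym (headTwice-* m (c′ (toℕ r)) λ p → q ^ (p ∸ toℕ r) * F m p)) ⟩
      t (suc m) * f + ∑[ r ≤ suc m ] headTwice m (λ p → c′ (toℕ r) * (q ^ (p ∸ toℕ r) * F m p))
        ≈⟨ +-congˡ (∑-headTwice (suc (suc m)) m λ r p → c′ (toℕ r) * (q ^ (p ∸ toℕ r) * F m p)) ⟩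
      t (suc m) * f + headTwice m (λ p → ∑[ r ≤ suc m ] (c′ (toℕ r) * (q ^ (p ∸ toℕ r) * F m p)))
        ≈⟨ +-congˡ (headTwice-cong m λ p p≤m → step p p≤m) ⟩
      t (suc m) * f + headTwice m (λ p → I t (suc m) * (q ^ p * F m p) + s * (q ^ p * T (suc k) (m ∸ p) * F m p))
        ≈⟨ +-congˡ (trans (headTwice-+ m (λ p → I t (suc m) * x p) (λ p → s * y p)) (+-cong (headTwice-* m (I t (suc m)) x) (headTwice-* m s y))) ⟩
      -- `headTwice m x` is `F (suc m) 0` by definition, as `i ∸ 0` is `i`, and `headTwice m y` is
      -- `G (suc k) m`.
      t (suc m) * f + (I t (suc m) * f + s * G (suc k) m)
        ≈⟨ solve 4 (λ x y f g → x :* f :+ (y :* f :+ g) := (x :+ y) :* f :+ g) refl _ _ f _ ⟩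
      T+IT k (suc m) * f + s * G (suc k) m ∎
      where
      t = T k
      f = F (suc m) 0
      x y c′ : ℕ → Carrier
      x p = q ^ p * F m p
      y p = q ^ p * T (suc k) (m ∸ p) * F m p
      c′ r = q ^ r * t (suc m ∸ r)
      step : ∀ p → p ℕ.≤ m → ∑[ r ≤ suc m ] (c′ (toℕ r) * (q ^ (p ∸ toℕ r) * F m p))
        ≈ I t (suc m) * (q ^ p * F m p) + s * (q ^ p * T (suc k) (m ∸ p) * F m p)
      step p p≤m = begin
        ∑[ r ≤ suc m ] (c′ (toℕ r) * (q ^ (p ∸ toℕ r) * F m p)) ≈⟨ sum-cong-≋ {suc (suc m)} (λ r → sym (*-assoc (c′ (toℕ r)) (q ^ (p ∸ toℕ r)) (F m p))) ⟩
        ∑[ r ≤ suc m ] (c′ (toℕ r) * q ^ (p ∸ toℕ r) * F m p)   ≈⟨ *-distribʳ-sum {suc (suc m)} (F m p) (λ r → c′ (toℕ r) * q ^ (p ∸ toℕ r)) ⟨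
        (∑[ r ≤ suc m ] (c′ (toℕ r) * q ^ (p ∸ toℕ r))) * F m p ≈⟨ *-congʳ (kernel′ t m p p≤m) ⟩
        q ^ p * (I t (suc m) + s * T (suc k) (m ∸ p)) * F m p
          ≈⟨ solve 5 (λ x i s j f → x :* (i :+ s :* j) :* f := i :* (x :* f) :+ s :* (x :* j :* f)) refl _ _ s _ _ ⟩
        I t (suc m) * (q ^ p * F m p) + s * (q ^ p * T (suc k) (m ∸ p) * F m p) ∎

    G-unroll : ∀ k m → G k m ≈ Σ< (λ i → T+IT (k ℕ.+ i) (m ∸ i) * s ^ i * F (m ∸ i) 0) (suc m)
    -- The unrolling ends here: `F 0 0` is 1 and `I` keeps the constant term, so the doubled head is
    -- already `T+IT k 0`.
    G-unroll k zero = begin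
      1# * T k 0 * 1# + (1# * T k 0 * 1# + 0#)
        ≈⟨ solve 3 (λ o t z → o :* t :* o :+ (o :* t :* o :+ z) := (t :+ t) :* o :* o :+ z) refl 1# (T k 0) 0# ⟩
      T+IT k 0 * 1# * 1# + 0#         ≡⟨ cong (λ j → T+IT j 0 * 1# * 1# + 0#) (ℕ.+-identityʳ k) ⟨
      T+IT (k ℕ.+ 0) 0 * 1# * 1# + 0# ∎
    G-unroll k (suc m) = begin
      G k (suc m)                                    ≈⟨ G-suc k m ⟩
      T+IT k (suc m) * F (suc m) 0 + s * G (suc k) m ≈⟨ +-cong (*-congʳ (sym (*-identityʳ _))) (*-congˡ (G-unroll (suc k) m)) ⟩
      T+IT k (suc m) * 1# * F (suc m) 0 + s * Σ< (λ i → T+IT (suc k ℕ.+ i) (m ∸ i) * s ^ i * F (m ∸ i) 0) (suc m)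
        ≈⟨ +-cong (reflexive (cong (λ j → T+IT j (suc m) * 1# * F (suc m) 0) (≡.sym (ℕ.+-identityʳ k)))) (Σ<-* (suc m) s λ i → T+IT (suc k ℕ.+ i) (m ∸ i) * s ^ i * F (m ∸ i) 0) ⟩
      T+IT (k ℕ.+ 0) (suc m) * 1# * F (suc m) 0 + Σ< (λ i → s * (T+IT (suc k ℕ.+ i) (m ∸ i) * s ^ i * F (m ∸ i) 0)) (suc m)
        ≈⟨ +-congˡ (Σ<-cong (suc m) λ i _ → trans
             (solve 4 (λ s x y z → s :* (x :* y :* z) := x :* (s :* y) :* z) refl s _ _ _)
             (reflexive (cong (λ j → T+IT j (m ∸ i) * s ^ suc i * F (m ∸ i) 0) (≡.sym (ℕ.+-suc k i))))) ⟩
      Σ< (λ i → T+IT (k ℕ.+ i) (suc m ∸ i) * s ^ i * F (suc m ∸ i) 0) (suc (suc m)) ∎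

    v : ℕ → ℕ → Carrier
    v k i = multichoose k i · q ^ i

    J-v : ∀ k i → J (v k) i ≈ v (suc k) i
    J-v k zero    = ×-congˡ (≡.trans (multichoose-0 k) (≡.sym (multichoose-0 (suc k))))
    J-v k (suc i) = begin
      q * J (v k) i + v k (suc i)                                             ≈⟨ +-congʳ (*-congˡ (J-v k i)) ⟩
      q * (multichoose (suc k) i · q ^ i) + multichoose k (suc i) · q ^ suc i ≈⟨ +-congʳ (×-comm-* (multichoose (suc k) i) q (q ^ i)) ⟩
      multichoose (suc k) i · q ^ suc i + multichoose k (suc i) · q ^ suc i   ≈⟨ ×-homo-+ (q ^ suc i) (multichoose (suc k) i) (multichoose k (suc i)) ⟨
      (multichoose (suc k) i ℕ.+ multichoose k (suc i)) · q ^ suc i           ≈⟨ ×-congˡ (multichoose-suc k i) ⟨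
      v (suc k) (suc i)                                                       ∎

    J-⊛ : ∀ w u d → J (w ⊛ u) d ≈ (J w ⊛ u) d
    J-⊛ w u zero    = refl
    J-⊛ w u (suc d) = begin
      q * J (w ⊛ u) d + (w 0 * u (suc d) + (w ∘ suc ⊛ u) d)            ≈⟨ +-congʳ (*-congˡ (J-⊛ w u d)) ⟩
      q * (J w ⊛ u) d + (w 0 * u (suc d) + (w ∘ suc ⊛ u) d)
        ≈⟨ solve 3 (λ x y z → x :+ (y :+ z) := y :+ (x :+ z)) refl _ _ _ ⟩
      w 0 * u (suc d) + (q * (J w ⊛ u) d + (w ∘ suc ⊛ u) d)           ≈⟨ +-congˡ (+-congʳ (⊛-scaleˡ q u (J w) d)) ⟨
      w 0 * u (suc d) + (((λ i → q * J w i) ⊛ u) d + (w ∘ suc ⊛ u) d) ≈⟨ +-congˡ (⊛-distribʳ u (λ i → q * J w i) (w ∘ suc) d) ⟨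
      (J w ⊛ u) (suc d)                                               ∎

    mutual
      -- `I` raises the index of the factor `u`, `J` that of `v`, and each passes through the
      -- product. So T_k splits into 1/(1-qz)^k and 1/(1-z)^{k+1}.
      T≈v⊛u : ∀ k d → T k d ≈ (v k ⊛ u k) d
      T≈v⊛u zero    d = sym (lemma d)
        where
        lemma : ∀ d → (v 0 ⊛ u 0) d ≈ 1#
        lemma zero    = trans (*-cong (×-homo-1 1#) (×-homo-1 1#)) (*-identityˡ 1#)
        lemma (suc d) = trans (+-cong (lemma 0) (⊛-zeroˡ (u 0) d)) (+-identityʳ 1#)
      T≈v⊛u (suc k) d = begin
        J (I (T k)) d             ≈⟨ J-cong (IT≈v⊛u k) d ⟩
        J (v k ⊛ u (suc k)) d     ≈⟨ J-⊛ (v k) (u (suc k)) d ⟩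
        (J (v k) ⊛ u (suc k)) d   ≈⟨ ⊛-cong (J-v k) (λ _ → refl) d ⟩
        (v (suc k) ⊛ u (suc k)) d ∎

      IT≈v⊛u : ∀ k d → I (T k) d ≈ (v k ⊛ u (suc k)) d
      IT≈v⊛u k d = begin
        I (T k) d           ≈⟨ I-cong (T≈v⊛u k) d ⟩
        I (v k ⊛ u k) d     ≈⟨ I-⊛ (v k) (u k) d ⟩
        (v k ⊛ I (u k)) d   ≈⟨ ⊛-cong {v k} (λ _ → refl) (I-u k) d ⟩
        (v k ⊛ u (suc k)) d ∎

    T+IT-explicit : ∀ k d → T+IT k d ≈ Σ< (λ i → coefficient k d i · q ^ i) (suc d)
    T+IT-explicit k d = begin
      T k d + I (T k) d                                            ≈⟨ +-cong (T≈v⊛u k d) (IT≈v⊛u k d) ⟩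
      (v k ⊛ u k) d + (v k ⊛ u (suc k)) d                          ≈⟨ +-cong (⊛-comm (v k) (u k) d) (⊛-comm (v k) (u (suc k)) d) ⟩
      (u k ⊛ v k) d + (u (suc k) ⊛ v k) d                          ≈⟨ ⊛-distribʳ (v k) (u k) (u (suc k)) d ⟨
      ((λ i → u k i + u (suc k) i) ⊛ v k) d                        ≈⟨ ⊛-comm (λ i → u k i + u (suc k) i) (v k) d ⟩
      (v k ⊛ λ i → u k i + u (suc k) i) d                          ≈⟨ ⊛-Σ< (v k) _ d ⟩
      Σ< (λ i → v k i * (u k (d ∸ i) + u (suc k) (d ∸ i))) (suc d) ≈⟨ Σ<-cong (suc d) (λ i _ → term i) ⟩
      Σ< (λ i → coefficient k d i · q ^ i) (suc d)                 ∎
      where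
      term : ∀ i → v k i * (u k (d ∸ i) + u (suc k) (d ∸ i)) ≈ coefficient k d i · q ^ i
      term i = begin
        (multichoose k i · q ^ i) * (paths k e · 1# + paths (suc k) e · 1#) ≈⟨ *-congˡ (×-homo-+ 1# (paths k e) (paths (suc k) e)) ⟨
        (multichoose k i · q ^ i) * (N · 1#)                                ≈⟨ ×-assoc-* (multichoose k i) (q ^ i) _ ⟩
        multichoose k i · (q ^ i * (N · 1#))                                ≈⟨ ×-congʳ (multichoose k i) (×-comm-* N (q ^ i) 1#) ⟩
        multichoose k i · (N · (q ^ i * 1#))                                ≈⟨ ×-congʳ (multichoose k i) (×-congʳ N (*-identityʳ _)) ⟩
        multichoose k i · (N · q ^ i)                                       ≈⟨ ×-assocˡ (q ^ i) (multichoose k i) N ⟩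
        coefficient k d i · q ^ i                                           ∎
        where
        e = d ∸ i
        N = paths k e ℕ.+ paths (suc k) e

    F-recurrence : ∀ m → F (suc m) 0
      ≈ Σ< (λ k → Σ< (λ i → coefficient k (m ∸ k) i · q ^ i) (suc (m ∸ k)) * s ^ k * F (m ∸ k) 0) (suc m)
    F-recurrence m = trans (F≈G m) (trans (G-unroll 0 m)
      (Σ<-cong (suc m) λ k _ → *-congʳ {F (m ∸ k) 0} (*-congʳ {s ^ k} (T+IT-explicit k (m ∸ k)))))

-- Flatten(σ) along the cycles of σ

Word : ℕ → Set
Word n = Vec (Fin n) n

-- The loops go and allB local to cycleOf and isCycleMinB have no name outside Defs; here unification
-- recovers them, as walk and noneBelow.  The fuel of go is tied to the size of σ.  To free it, cong! is
-- asked to prove that fuels suc t and t give the same list if suc t ≡ t: the function that it applies to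
-- this (absurd) equation is go with arbitrary fuel.
mutual
  walkFrom : ∀ {t} → Word (suc t) → (i x : Fin (suc t)) → List (Fin (suc t))
  walkFrom = _

  cycleOf≡ : ∀ {t} (σ : Word (suc t)) i → cycleOf σ i ≡ i ∷ walkFrom σ i (lookup σ i)
  cycleOf≡ σ i with lookup σ i
  ... | _ = ≡.refl

-- As used in `fuelPath`, both lists are the loop of `cycleOf` run from `lookup σ i`: `u` has fuel
-- `suc t`, while `v`, exposed by one turn of the loop from `i` itself, has fuel `t`.
walk-tails : ∀ {t} (σ : Word (suc t)) i {u v : List (Fin (suc t))} → cycleOf σ i ≡ i ∷ u →
  walkFrom σ i i ≡ (if ⌊ i Fin.≟ i ⌋ then [] else (i ∷ v)) → u ≡ v → u ≡ v
walk-tails σ i _ _ p = p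

fuelPath : ∀ {t} (e : suc t ≡ t) (σ : Word (suc t)) i → _
fuelPath e σ i = walk-tails σ i ≡.refl ≡.refl (cong! e)

-- Hides the end points of an equation, since those of a congruence mention the function to be found.
data Path (B : Set) : Set where
  path : {u v : B} → u ≡ v → Path B

mutual
  walkFromImage : ∀ {t} → Word (suc t) → (i : Fin (suc t)) → ℕ → List (Fin (suc t))
  walkFromImage = _

  fuelPath≡ : ∀ {t} (e : suc t ≡ t) (σ : Word (suc t)) i → path (fuelPath e σ i) ≡ path (cong (λ k → walkFromImage σ i k) e)
  fuelPath≡ e σ i = ≡.refl

mutual
  walk : ∀ {t} → Word (suc t) → (i : Fin (suc t)) → ℕ → Fin (suc t) → List (Fin (suc t))
  walk = _

  walkFromImage≡ : ∀ {t} (σ : Word (suc t)) i k → walkFromImage σ i k ≡ walk σ i k (lookup σ i)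
  walkFromImage≡ σ i k with lookup σ i
  ... | _ = ≡.refl

mutual
  noneBelow : ∀ {t} → Word (suc t) → (i : Fin (suc t)) → List (Fin (suc t)) → Bool
  noneBelow = _

  isCycleMinB≡ : ∀ {t} (σ : Word (suc t)) i →
    isCycleMinB σ i ≡ not (toℕ i <ᵇ toℕ i) ∧ noneBelow σ i (walk σ i (suc t) (lookup σ i))
  isCycleMinB≡ {t} σ i with walk σ i (suc t) (lookup σ i)
  ... | _ = ≡.refl

<ᵇ-true : ∀ {m n} → m ℕ.< n → (m <ᵇ n) ≡ true
<ᵇ-true {zero}  (s≤s z≤n)         = ≡.refl
<ᵇ-true {suc m} (s≤s m<n@(s≤s _)) = <ᵇ-true m<n

<ᵇ-false : ∀ {m n} → n ≤ m → (m <ᵇ n) ≡ false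
<ᵇ-false {m} z≤n       = ≡.refl
<ᵇ-false     (s≤s n≤m) = <ᵇ-false n≤m

-- Sorted vectors of remaining letters, and the runs through them

Sorted : ∀ {n m} → Vec (Fin n) m → Set
Sorted = AllPairs Fin._<_

All-removeAt : ∀ {A : Set} {P : A → Set} {m} {U : Vec A (suc m)} → VAll.All P U → ∀ i → VAll.All P (removeAt U i)
All-removeAt (p ∷ ps)         zero    = ps
All-removeAt (p ∷ ps@(_ ∷ _)) (suc i) = p ∷ All-removeAt ps i

Sorted-removeAt : ∀ {n m} {U : Vec (Fin n) (suc m)} → Sorted U → ∀ i → Sorted (removeAt U i)
Sorted-removeAt (y< ∷ s)         zero    = s
Sorted-removeAt (y< ∷ s@(_ ∷ _)) (suc i) = All-removeAt y< i ∷ Sorted-removeAt s i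

lookup≢removeAt : ∀ {n m} {U : Vec (Fin n) (suc m)} → Sorted U → ∀ i → VAll.All (lookup U i ≢_) (removeAt U i)
lookup≢removeAt (y< ∷ s)         zero    = VAll.map Fin.<⇒≢ y<
lookup≢removeAt (y< ∷ s@(_ ∷ _)) (suc i) = (Fin.<⇒≢ (VAll.lookup⁺ y< i) ∘ ≡.sym) ∷ lookup≢removeAt s i

-- Runs σ c x U u: if x is the last letter written, in the cycle opened by c, and U are the remaining
-- letters, then u is the rest of Flatten(σ).
data Runs {n} (σ : Word n) : (c x : Fin n) → ∀ {m} → Vec (Fin n) m → List (Fin n) → Set where
  done  : ∀ {c x} → lookup σ x ≡ c → Runs σ c x [] []
  step  : ∀ {c x m} {U : Vec (Fin n) (suc m)} {u} i → lookup σ x ≡ lookup U i →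
          Runs σ c (lookup U i) (removeAt U i) u → Runs σ c x U (lookup U i ∷ u)
  close : ∀ {c x m h} {U : Vec (Fin n) m} {u} → lookup σ x ≡ c →
          Runs σ h h U u → Runs σ c x (h ∷ U) (h ∷ u)

module _ {t} (σ : Word (suc t)) where

  data Walk (c : Fin (suc t)) : Fin (suc t) → List (Fin (suc t)) → Set where
    back : ∀ {x} → lookup σ x ≡ c → Walk c x []
    next : ∀ {x y l} → lookup σ x ≡ y → Walk c y l → Walk c x (y ∷ l)

  -- The loop stops on return to `c`, so it follows a `Walk` that avoids `c`; the fuel beyond the
  -- length pays for detecting the return.
  walk-Walk : ∀ {c x l} k → Walk c x l → All (c ≢_) l → length l ℕ.< k → walk σ c k (lookup σ x) ≡ l
  walk-Walk {c} (suc k) (back ≡.refl) [] _ with c Fin.≟ c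
  ... | yes _  = ≡.refl
  ... | no c≢c = contradiction ≡.refl c≢c
  walk-Walk {c} (suc k) (next {y = y} ≡.refl w) (c≢y ∷ c∉l) (s≤s l<k) with y Fin.≟ c
  ... | yes y≡c = contradiction (≡.sym y≡c) c≢y
  ... | no _    = cong (y ∷_) (walk-Walk k w c∉l l<k)

  noneBelow-true : ∀ i {l} → All (i Fin.<_) l → noneBelow σ i l ≡ true
  noneBelow-true i []         = ≡.refl
  noneBelow-true i (i<x ∷ ps) = cong₂ _∧_ (cong not (<ᵇ-false (ℕ.<⇒≤ i<x))) (noneBelow-true i ps)

  -- The loop for `y` is followed from `x` onwards. As `y` is not in `l`, it cannot stop before
  -- reaching `c`, and `c` is a smaller letter of the same cycle; what comes after `c` cannot make
  -- the conjunction true again.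
  noneBelow-walk : ∀ {c x y l} k → Walk c x l → c Fin.< y → All (y ≢_) l → length l ℕ.< k →
    noneBelow σ y (walk σ y k (lookup σ x)) ≡ false
  noneBelow-walk {c} {x} {y} (suc k) (back ≡.refl) c<y [] _ with c Fin.≟ y
  ... | yes c≡y = contradiction c≡y (Fin.<⇒≢ c<y)
  ... | no _    = cong (λ b → not b ∧ noneBelow σ y (walk σ y k (lookup σ (lookup σ x)))) (<ᵇ-true c<y)
  noneBelow-walk {y = y} (suc k) (next {y = z} ≡.refl w) c<y (y≢z ∷ y∉l) (s≤s l<k) with z Fin.≟ y
  ... | yes z≡y = contradiction (≡.sym z≡y) y≢z
  ... | no _    = ≡.trans (cong (not (toℕ z <ᵇ toℕ y) ∧_) (noneBelow-walk k w c<y y∉l l<k)) (Bool.∧-zeroʳ _)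

  block : Fin (suc t) → List ℕ
  block i = if isCycleMinB σ i then map toℕ (cycleOf σ i) else []

  block-min : ∀ {c l} → Walk c c l → All (c Fin.<_) l → length l ≤ t → block c ≡ map toℕ (c ∷ l)
  block-min {c} {l} w c< l≤t = ≡.trans
    (cong (λ l → if not (toℕ c <ᵇ toℕ c) ∧ noneBelow σ c l then map toℕ (c ∷ l) else [])
      (walk-Walk (suc t) w (All.map Fin.<⇒≢ c<) (s≤s l≤t)))
    (cong (λ b → if b then map toℕ (c ∷ l) else [])
      (cong₂ (λ a b → not a ∧ b) (<ᵇ-false (ℕ.≤-refl {toℕ c})) (noneBelow-true c c<)))

  block-nonmin : ∀ {c y l} → Walk c y l → c Fin.< y → All (y ≢_) l → length l ≤ t → block y ≡ []
  block-nonmin {y = y} w c<y y∉l l≤t = cong (λ b → if b then map toℕ (cycleOf σ y) else [])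
    (≡.trans (cong (not (toℕ y <ᵇ toℕ y) ∧_) (noneBelow-walk (suc t) w c<y y∉l (s≤s l≤t))) (Bool.∧-zeroʳ _))

  concatMap-removeAt : ∀ {m} (U : Vec (Fin (suc t)) (suc m)) i → block (lookup U i) ≡ [] →
    concatMap block (toList U) ≡ concatMap block (toList (removeAt U i))
  concatMap-removeAt (y ∷ U)         zero    e = cong (_++ concatMap block (toList U)) e
  concatMap-removeAt (y ∷ U@(_ ∷ _)) (suc i) e = cong (block y ++_) (concatMap-removeAt U i e)

  -- `current` finishes the open cycle and `later` holds the cycles still to be opened. `current⊆`
  -- quantifies over predicates because it is applied both to `c <` and to `y ≢`; `shorter` bounds
  -- the fuel.
  record CycleSplit (c x : Fin (suc t)) {m} (U : Vec (Fin (suc t)) m) (u : List (Fin (suc t))) : Set₁ where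
    field
      {current later} : List (Fin (suc t))
      u≡       : u ≡ current ++ later
      returns  : Walk c x current
      current⊆ : ∀ {P : Fin (suc t) → Set} → VAll.All P U → All P current
      shorter  : length current ≤ m
      blocks   : concatMap block (toList U) ≡ map toℕ later

  open CycleSplit

  new-block : ∀ {h m} {U : Vec (Fin (suc t)) m} {u} → m ≤ t → VAll.All (h Fin.<_) U →
    CycleSplit h h U u → concatMap block (h ∷ toList U) ≡ map toℕ (h ∷ u)
  new-block {h} {U = U} {u} m≤t h< s = begin
    block h ++ concatMap block (toList U)        ≡⟨ cong₂ _++_ (block-min (returns s) (current⊆ s h<) (ℕ.≤-trans (shorter s) m≤t)) (blocks s) ⟩
    map toℕ (h ∷ current s) ++ map toℕ (later s) ≡⟨ map-++ toℕ (h ∷ current s) (later s) ⟨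
    map toℕ (h ∷ current s ++ later s)           ≡⟨ cong (λ u → map toℕ (h ∷ u)) (u≡ s) ⟨
    map toℕ (h ∷ u)                              ∎
    where open ≡.≡-Reasoning

  -- A letter chosen by `step` shares its cycle with the smaller `c`, so its block is empty and
  -- deleting it from `U` changes nothing. `close` takes the head of the sorted `U`, which is the
  -- minimum of its cycle, and its block is that whole cycle.
  runs-split : ∀ {c x m} {U : Vec (Fin (suc t)) m} {u} → m ≤ t → Sorted U → VAll.All (c Fin.<_) U → Runs σ c x U u → CycleSplit c x U u
  runs-split m≤t s c< (done e) = record
    { current = [] ; later = [] ; u≡ = ≡.refl ; returns = back e ; current⊆ = λ _ → [] ; shorter = z≤n ; blocks = ≡.refl }
  runs-split {U = U} m≤t s c< (step i e r) = record
    { u≡       = cong (lookup U i ∷_) (u≡ s′)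
    ; returns  = next e (returns s′)
    ; current⊆ = λ ps → VAll.lookup⁺ ps i ∷ current⊆ s′ (All-removeAt ps i)
    ; shorter  = s≤s (shorter s′)
    ; blocks   = ≡.trans
        (concatMap-removeAt U i (block-nonmin (returns s′) (VAll.lookup⁺ c< i) (current⊆ s′ (lookup≢removeAt s i))
          (ℕ.≤-trans (shorter s′) (ℕ.<⇒≤ m≤t))))
        (blocks s′)
    }
    where s′ = runs-split (ℕ.<⇒≤ m≤t) (Sorted-removeAt s i) (All-removeAt c< i) r
  runs-split m≤t (h< ∷ s) c< (close e r) = record
    { current = [] ; u≡ = ≡.refl ; returns = back e ; current⊆ = λ _ → [] ; shorter = z≤n
    ; blocks  = new-block (ℕ.<⇒≤ m≤t) h< (runs-split (ℕ.<⇒≤ m≤t) s h< r) }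

toList-tabulate : ∀ {A : Set} {m} (f : Fin m → A) → toList (tabulate f) ≡ List.tabulate f
toList-tabulate {m = zero}  f = ≡.refl
toList-tabulate {m = suc m} f = cong (f zero ∷_) (toList-tabulate (f ∘ suc))

tabulate-sorted : ∀ {n m} (f : Fin m → Fin n) → (∀ {i j} → i Fin.< j → f i Fin.< f j) → Sorted (tabulate f)
tabulate-sorted {m = zero}  f mono = []
tabulate-sorted {m = suc m} f mono = VAll.tabulate⁺ (λ i → mono ℕ.z<s) ∷ tabulate-sorted (f ∘ suc) (mono ∘ s≤s)

flatten-runs : ∀ {t} (σ : Word (suc t)) {u} → Runs σ zero zero (tabulate suc) u → flatten σ ≡ map toℕ (zero ∷ u)
flatten-runs {t} σ r = ≡.trans (cong (λ l → concatMap (block σ) (zero ∷ l)) (≡.sym (toList-tabulate {m = t} suc)))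
  (new-block σ {U = tabulate suc} ℕ.≤-refl positive (runs-split σ ℕ.≤-refl (tabulate-sorted suc s≤s) positive r))
  where
  positive : VAll.All (Fin._<_ (zero {t})) (tabulate {n = t} suc)
  positive = VAll.tabulate⁺ {f = suc} (λ i → ℕ.z<s)

-- The tree of possible continuations

removeAt-↭ : ∀ {A : Set} {m} (U : Vec A (suc m)) i → lookup U i ∷ toList (removeAt U i) ↭ toList U
removeAt-↭ (y ∷ U)         zero    = ↭.↭-refl
removeAt-↭ (y ∷ U@(_ ∷ _)) (suc i) = ↭.↭-trans (↭.swap _ y ↭.↭-refl) (↭.prep y (removeAt-↭ U i))

-- When two adjacent letters have been written, the order of the later ones is still open; the
-- occurrences that begin at this pair depend only on which letters remain.
countBetween-↭ : ∀ a b {u v} → u ↭ v → countBetween a b u ≡ countBetween a b v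
countBetween-↭ a b ↭.refl         = ≡.refl
countBetween-↭ a b (↭.prep x p)   = cong (_ ℕ.+_) (countBetween-↭ a b p)
countBetween-↭ a b (↭.swap {u} {v} x y p) = begin
  X ℕ.+ (Y ℕ.+ countBetween a b u) ≡⟨ cong (λ n → X ℕ.+ (Y ℕ.+ n)) (countBetween-↭ a b p) ⟩
  X ℕ.+ (Y ℕ.+ countBetween a b v) ≡⟨ ℕ.+-assoc X Y _ ⟨
  X ℕ.+ Y ℕ.+ countBetween a b v   ≡⟨ cong (ℕ._+ countBetween a b v) (ℕ.+-comm X Y) ⟩
  Y ℕ.+ X ℕ.+ countBetween a b v   ≡⟨ ℕ.+-assoc Y X _ ⟩
  Y ℕ.+ (X ℕ.+ countBetween a b v) ∎
  where
  open ≡.≡-Reasoning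
  X = if (a <ᵇ x) ∧ (x <ᵇ b) then 1 else 0
  Y = if (a <ᵇ y) ∧ (y <ᵇ b) then 1 else 0
countBetween-↭ a b (↭.trans p r)  = ≡.trans (countBetween-↭ a b p) (countBetween-↭ a b r)

data Rank {n} (x : Fin n) : ℕ → ∀ {m} → Vec (Fin n) m → Set where
  above : ∀ {m} {U : Vec (Fin n) m} → VAll.All (x Fin.<_) U → Rank x 0 U
  below : ∀ {m r y} {U : Vec (Fin n) m} → y Fin.< x → Rank x r U → Rank x (suc r) (y ∷ U)

rank-removeAt : ∀ {n m} {U : Vec (Fin n) (suc m)} → Sorted U → ∀ i → Rank (lookup U i) (toℕ i) (removeAt U i)
rank-removeAt (y< ∷ s)         zero    = above y<
rank-removeAt (y< ∷ s@(_ ∷ _)) (suc i) = below (VAll.lookup⁺ y< i) (rank-removeAt s i)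

countBetween-above : ∀ a {n m} {y : Fin n} {U : Vec (Fin n) m} → VAll.All (y Fin.<_) U → countBetween a (toℕ y) (map toℕ (toList U)) ≡ 0
countBetween-above a []       = ≡.refl
countBetween-above a {y = y} (_∷_ {x = z} y<z ps)
  rewrite <ᵇ-false (ℕ.<⇒≤ y<z) | Bool.∧-zeroʳ (a <ᵇ toℕ z) = countBetween-above a ps

-- In the sorted `U` the letters below the chosen one are the first `i`, and those below `x` the
-- first `r`. Truncated subtraction covers the choices below `x`.
countBetween-rank : ∀ {n m r} {x : Fin n} {U : Vec (Fin n) (suc m)} → Sorted U → Rank x r U → ∀ i →
  countBetween (toℕ x) (toℕ (lookup U i)) (map toℕ (toList (removeAt U i))) ≡ toℕ i ∸ r
countBetween-rank {r = r} {x} (y< ∷ s) rk zero = ≡.trans (countBetween-above (toℕ x) y<) (≡.sym (ℕ.0∸n≡0 r))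
countBetween-rank (y< ∷ s@(_ ∷ _)) (above (x<y ∷ x<)) (suc i)
  rewrite <ᵇ-true x<y | <ᵇ-true (VAll.lookup⁺ y< i) = cong suc (countBetween-rank s (above x<) i)
countBetween-rank (y< ∷ s@(_ ∷ _)) (below y<x rk) (suc i)
  rewrite <ᵇ-false (ℕ.<⇒≤ y<x) = countBetween-rank s rk i

module Successions {c ℓ} (S : CommutativeSemiring c ℓ) where
  open CommutativeSemiring S hiding (zero)
  open Recurrence S
  open import Algebra.Properties.Semiring.Exp semiring using (^-homo-*)
  open SetoidReasoning setoid

  -- Σ φ(u) over the orders u in which the letters of U can follow in a flattened word; the least
  -- remaining letter comes up twice, as it either continues the current cycle or starts the next one.
  E : ∀ {A : Set} m → Vec A m → (List A → Carrier) → Carrier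
  E zero    U φ = φ []
  E (suc m) U φ = pick zero + ∑[ i ≤ m ] pick i
    where
    pick : Fin (suc m) → Carrier
    pick i = E m (removeAt U i) (φ ∘ (lookup U i ∷_))

  E-cong : ∀ {A : Set} m (U : Vec A m) {φ ψ} → (∀ {u} → u ↭ toList U → φ u ≈ ψ u) → E m U φ ≈ E m U ψ
  E-cong zero    [] p = p ↭.↭-refl
  E-cong (suc m) U {φ} {ψ} p = +-cong (pick zero) (sum-cong-≋ pick)
    where
    pick : ∀ i → E m (removeAt U i) (φ ∘ (lookup U i ∷_)) ≈ E m (removeAt U i) (ψ ∘ (lookup U i ∷_))
    pick i = E-cong m (removeAt U i) (λ u↭ → p (↭.↭-trans (↭.prep _ u↭) (removeAt-↭ U i)))

  E-* : ∀ {A : Set} m (U : Vec A m) a φ → E m U (λ u → a * φ u) ≈ a * E m U φ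
  E-* zero    U a φ = refl
  E-* (suc m) U a φ = begin
    E (suc m) U (λ u → a * φ u)             ≈⟨ +-cong (E-* m _ a _) (sum-cong-≋ {suc m} λ i → E-* m (removeAt U i) a (φ ∘ (lookup U i ∷_))) ⟩
    a * pick zero + ∑[ i ≤ m ] (a * pick i) ≈⟨ +-congˡ (*-distribˡ-sum {suc m} a pick) ⟨
    a * pick zero + a * ∑[ i ≤ m ] pick i   ≈⟨ distribˡ a _ _ ⟨
    a * E (suc m) U φ                       ∎
    where
    pick : Fin (suc m) → Carrier
    pick i = E m (removeAt U i) (φ ∘ (lookup U i ∷_))

  module _ (q s : Carrier) (q≈1+s : q ≈ 1# + s) where

    -- The occurrences at the pair `x`, `y` are the same for all orders of the rest, so their power
    -- of q factors out of `E`; the rank of `y` in the rest is then its position in `U`.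
    E-occ : ∀ {n} m (U : Vec (Fin n) m) x r → Sorted U → Rank x r U →
      E m U (λ u → q ^ occ13-2 (map toℕ (x ∷ u))) ≈ F q s q≈1+s m r
    E-occ zero    [] x r so rk = refl
    E-occ (suc m) U  x r so rk = +-cong (pick zero) (sum-cong-≋ pick)
      where
      pick : ∀ i → E m (removeAt U i) (λ u → q ^ occ13-2 (map toℕ (x ∷ lookup U i ∷ u)))
        ≈ q ^ (toℕ i ∸ r) * F q s q≈1+s m (toℕ i)
      pick i = begin
        E m (removeAt U i) (λ u → q ^ (countBetween (toℕ x) (toℕ y) (map toℕ u) ℕ.+ occ13-2 (map toℕ (y ∷ u))))
          ≈⟨ E-cong m (removeAt U i) (λ {u} u↭ → trans
               (^-homo-* q (countBetween (toℕ x) (toℕ y) (map toℕ u)) _)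
               (*-congʳ (reflexive (cong (q ^_) (≡.trans
                 (countBetween-↭ (toℕ x) (toℕ y) (↭.map⁺ toℕ u↭)) (countBetween-rank so rk i)))))) ⟩
        E m (removeAt U i) (λ u → q ^ (toℕ i ∸ r) * q ^ occ13-2 (map toℕ (y ∷ u)))
          ≈⟨ E-* m (removeAt U i) (q ^ (toℕ i ∸ r)) _ ⟩
        q ^ (toℕ i ∸ r) * E m (removeAt U i) (λ u → q ^ occ13-2 (map toℕ (y ∷ u)))
          ≈⟨ *-congˡ (E-occ m (removeAt U i) y (toℕ i) (Sorted-removeAt so i) (rank-removeAt so i)) ⟩
        q ^ (toℕ i ∸ r) * F q s q≈1+s m (toℕ i) ∎
        where y = lookup U i

-- Sums over all permutations

memB-false⁻ : ∀ {n m} (x : Fin n) (v : Vec (Fin n) m) → memB x (toList v) ≡ false → VAll.All (x ≢_) v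
memB-false⁻ x []      e = []
memB-false⁻ x (y ∷ v) e with x Fin.≟ y
... | no x≢y = x≢y ∷ memB-false⁻ x v e

memB-false⁺ : ∀ {n m} {x : Fin n} {v : Vec (Fin n) m} → VAll.All (x ≢_) v → memB x (toList v) ≡ false
memB-false⁺ []                        = ≡.refl
memB-false⁺ {x = x} (_∷_ {x = y} x≢y ps) with x Fin.≟ y
... | yes x≡y = contradiction x≡y x≢y
... | no _    = memB-false⁺ ps

distinctB⁻ : ∀ {n m} (v : Vec (Fin n) m) → distinctB (toList v) ≡ true → Vec.Unique v
distinctB⁻ []      e = []
distinctB⁻ (x ∷ v) e with memB x (toList v) in eq
... | false = memB-false⁻ x v eq ∷ distinctB⁻ v e

distinctB⁺ : ∀ {n m} {v : Vec (Fin n) m} → Vec.Unique v → distinctB (toList v) ≡ true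
distinctB⁺ []       = ≡.refl
distinctB⁺ (p ∷ ps) = cong₂ (λ a b → not a ∧ b) (memB-false⁺ p) (distinctB⁺ ps)

prepend : ∀ {n m} → Vec (Fin m) n → Fin m → Vec (Fin m) (suc n)
prepend w x = x ∷ w

allWords-suc : ∀ n m → allWords (suc n) m ≡ cartesianProductWith prepend (allWords n m) (List.allFin m)
allWords-suc n m = go (allWords n m)
  where
  go : ∀ ws → concatMap (λ w → map (λ x → x ∷ w) (List.allFin m)) ws ≡ cartesianProductWith prepend ws (List.allFin m)
  go []       = ≡.refl
  go (w ∷ ws) = cong (map (prepend w) (List.allFin m) List.++_) (go ws)

allWords-unique : ∀ n m → List.Unique (allWords n m)
allWords-unique zero    m = [] ∷ []
allWords-unique (suc n) m rewrite allWords-suc n m =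
  Unique.cartesianProductWith⁺ prepend (λ e → Vec.∷-injectiveʳ e , Vec.∷-injectiveˡ e) (allWords-unique n m) (Unique.allFin⁺ m)

∈-allWords : ∀ {n m} (w : Vec (Fin m) n) → w List.∈ allWords n m
∈-allWords []      = here ≡.refl
∈-allWords {suc n} {m} (x ∷ w) rewrite allWords-suc n m = List.∈-cartesianProductWith⁺ prepend (∈-allWords w) (List.∈-allFin x)

perms-unique : ∀ n → List.Unique (perms n)
perms-unique n = Unique.filter⁺ _ (allWords-unique n n)

∈-perms : ∀ {n} {σ : Word n} → Vec.Unique σ → σ List.∈ perms n
∈-perms {σ = σ} u = List.∈-filter⁺ _ (∈-allWords σ) (distinctB⁺ u)

perms-injective : ∀ {n} {σ : Word n} → σ List.∈ perms n → ∀ {i j} → lookup σ i ≡ lookup σ j → i ≡ j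
perms-injective {n} {σ} σ∈ = VUnique.lookup-injective
  (distinctB⁻ σ (proj₂ (List.∈-filter⁻ (λ σ → isPermB σ Bool.≟ true) {xs = allWords n n} σ∈))) _ _

-- Partly revealed permutations

∈-removeAt⁺ : ∀ {A : Set} {m a} {U : Vec A (suc m)} i → a ∈ U → a ∈ lookup U i ∷ removeAt U i
∈-removeAt⁺ {U = y ∷ U}         zero    p         = p
∈-removeAt⁺ {U = y ∷ U@(_ ∷ _)} (suc i) (here e)  = there (here e)
∈-removeAt⁺ {U = y ∷ U@(_ ∷ _)} (suc i) (there p) with ∈-removeAt⁺ i p
... | here e  = here e
... | there q = there (there q)

∈-removeAt⁻ : ∀ {A : Set} {m a} {U : Vec A (suc m)} i → a ∈ lookup U i ∷ removeAt U i → a ∈ U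
∈-removeAt⁻ {U = y ∷ U}         zero    p                 = p
∈-removeAt⁻ {U = y ∷ U@(_ ∷ _)} (suc i) (here e)          = there (∈-removeAt⁻ i (here e))
∈-removeAt⁻ {U = y ∷ U@(_ ∷ _)} (suc i) (there (here e))  = here e
∈-removeAt⁻ {U = y ∷ U@(_ ∷ _)} (suc i) (there (there p)) = there (∈-removeAt⁻ i (there p))

unique-removeAt : ∀ {A : Set} {m} {U : Vec A (suc m)} → Vec.Unique U → ∀ i → VAll.All (lookup U i ≢_) (removeAt U i) × Vec.Unique (removeAt U i)
unique-removeAt (p ∷ ps)         zero    = p , ps
unique-removeAt (p ∷ ps@(_ ∷ _)) (suc i) with unique-removeAt ps i
... | q , qs = ((VAll.lookup⁺ p i ∘ ≡.sym) ∷ q) , (All-removeAt p i ∷ qs)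

All≢⇒∉ : ∀ {A : Set} {m a} {U : Vec A m} → VAll.All (a ≢_) U → a ∉ U
All≢⇒∉ (p ∷ ps) (here e)  = p e
All≢⇒∉ (p ∷ ps) (there q) = All≢⇒∉ ps q

transposeˡ : ∀ {n} (i j : Fin n) → transpose i j ⟨$⟩ʳ i ≡ j
transposeˡ i j rewrite dec-true (i Fin.≟ i) ≡.refl = ≡.refl

transposeʳ : ∀ {n} (i j : Fin n) → transpose i j ⟨$⟩ʳ j ≡ i
transposeʳ i j with j Fin.≟ i
... | yes j≡i = j≡i
... | no _ rewrite dec-true (j Fin.≟ j) ≡.refl = ≡.refl

transpose-other : ∀ {n} {i j k : Fin n} → k ≢ i → k ≢ j → transpose i j ⟨$⟩ʳ k ≡ k
transpose-other {i = i} {j} {k} k≢i k≢j rewrite dec-false (k Fin.≟ i) k≢i | dec-false (k Fin.≟ j) k≢j = ≡.refl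

⟨$⟩ʳ-injective : ∀ {n} (τ : Permutation′ n) {a b} → τ ⟨$⟩ʳ a ≡ τ ⟨$⟩ʳ b → a ≡ b
⟨$⟩ʳ-injective τ e = ≡.trans (≡.sym (inverseˡ τ)) (≡.trans (cong (τ ⟨$⟩ˡ_) e) (inverseˡ τ))

Agree : ∀ {n m} → Permutation′ n → Vec (Fin n) m → Word n → Set
Agree τ D σ = ∀ a → a ∉ D → lookup σ a ≡ τ ⟨$⟩ʳ a

Agree? : ∀ {n m} (τ : Permutation′ n) (D : Vec (Fin n) m) σ → Dec (Agree τ D σ)
Agree? τ D σ = Fin.all? λ a → ¬? (a ∈? D) →-dec (lookup σ a Fin.≟ τ ⟨$⟩ʳ a)
  where open VDec Fin._≟_ using (_∈?_)

-- `τ` completes the values revealed so far: the open cycle, begun at `c`, is closed by sending `x`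
-- to `c`, and the letters of `U` are fixed points. The values at `x` and on `U` are the undecided
-- ones.
module State {n m} (τ : Permutation′ n) (c x : Fin n) (U : Vec (Fin n) m)
             (x∉U : VAll.All (x ≢_) U) (τx≡c : τ ⟨$⟩ʳ x ≡ c) (fixed : VAll.All (λ u → τ ⟨$⟩ʳ u ≡ u) U) where

  open VDec (Fin._≟_ {n}) using (_∈?_)

  c∉U : VAll.All (c ≢_) U
  c∉U = VAll.lookup⁻ λ i c≡u → VAll.lookup⁺ x∉U i
    (⟨$⟩ʳ-injective τ (≡.trans τx≡c (≡.trans c≡u (≡.sym (VAll.lookup⁺ fixed i)))))

  -- Let a be the preimage of σ(x) under `τ`. If a were outside `x ∷ U`, then σ(a) = τ(a) = σ(x),
  -- and injectivity of σ would force a = x.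
  value : ∀ {σ} → σ List.∈ perms n → Agree τ (x ∷ U) σ → lookup σ x ≡ c ⊎ ∃ λ i → lookup σ x ≡ lookup U i
  value {σ} σ∈ agree with (τ ⟨$⟩ˡ lookup σ x) ∈? (x ∷ U)
  ... | yes (here e)  = inj₁ (≡.trans (≡.sym (inverseʳ τ)) (≡.trans (cong (τ ⟨$⟩ʳ_) e) τx≡c))
  ... | yes (there p) = inj₂ (VAny.index p , (begin
      lookup σ x                     ≡⟨ inverseʳ τ ⟨
      τ ⟨$⟩ʳ (τ ⟨$⟩ˡ lookup σ x)     ≡⟨ cong (τ ⟨$⟩ʳ_) (VAny.lookup-index p) ⟩
      τ ⟨$⟩ʳ lookup U (VAny.index p) ≡⟨ VAll.lookup⁺ fixed (VAny.index p) ⟩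
      lookup U (VAny.index p)             ∎))
    where open ≡.≡-Reasoning
  ... | no a∉         = contradiction (here (perms-injective σ∈ (≡.trans (agree _ a∉) (inverseʳ τ)))) a∉

  agree-close⁻ : ∀ σ → Agree τ U σ → Agree τ (x ∷ U) σ × lookup σ x ≡ c
  agree-close⁻ σ agree = (λ a a∉ → agree a (a∉ ∘ there)) , ≡.trans (agree x (All≢⇒∉ x∉U)) τx≡c

  agree-close⁺ : ∀ σ → Agree τ (x ∷ U) σ → lookup σ x ≡ c → Agree τ U σ
  agree-close⁺ σ agree e a a∉U with a Fin.≟ x
  ... | yes ≡.refl = ≡.trans e (≡.sym τx≡c)
  ... | no a≢x   = agree a λ { (here a≡x) → a≢x a≡x ; (there a∈U) → a∉U a∈U }

module Step {n m} (τ : Permutation′ n) (c x : Fin n) (U : Vec (Fin n) (suc m))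
            (x∉U : VAll.All (x ≢_) U) (τx≡c : τ ⟨$⟩ʳ x ≡ c) (fixed : VAll.All (λ u → τ ⟨$⟩ʳ u ≡ u) U)
            (i : Fin (suc m)) where

  open State τ c x U x∉U τx≡c fixed

  y : Fin n
  y = lookup U i

  -- τ redirected so that x maps to y; then y maps to c, and all other values are unchanged.
  τ′ : Permutation′ n
  τ′ = τ ∘ₚ transpose c y

  τ′x≡y : τ′ ⟨$⟩ʳ x ≡ y
  τ′x≡y = ≡.trans (cong (transpose c y ⟨$⟩ʳ_) τx≡c) (transposeˡ c y)

  τ′y≡c : τ′ ⟨$⟩ʳ y ≡ c
  τ′y≡c = ≡.trans (cong (transpose c y ⟨$⟩ʳ_) (VAll.lookup⁺ fixed i)) (transposeʳ c y)

  τ′-other : ∀ {a} → a ≢ x → a ≢ y → τ′ ⟨$⟩ʳ a ≡ τ ⟨$⟩ʳ a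
  τ′-other a≢x a≢y = transpose-other
    (λ e → a≢x (⟨$⟩ʳ-injective τ (≡.trans e (≡.sym τx≡c))))
    (λ e → a≢y (⟨$⟩ʳ-injective τ (≡.trans e (≡.sym (VAll.lookup⁺ fixed i)))))

  fixed′ : Vec.Unique U → VAll.All (λ u → τ′ ⟨$⟩ʳ u ≡ u) (removeAt U i)
  fixed′ u = VAll.lookup⁻ λ j → ≡.trans
    (τ′-other (VAll.lookup⁺ (All-removeAt x∉U i) j ∘ ≡.sym) (VAll.lookup⁺ (proj₁ (unique-removeAt u i)) j ∘ ≡.sym))
    (VAll.lookup⁺ (All-removeAt fixed i) j)

  agree-step⁻ : ∀ σ → Agree τ′ (y ∷ removeAt U i) σ → Agree τ (x ∷ U) σ × lookup σ x ≡ y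
  agree-step⁻ σ agree =
    (λ a a∉ → ≡.trans (agree a (λ p → a∉ (there (∈-removeAt⁻ i p))))
      (τ′-other (a∉ ∘ here) (λ a≡y → a∉ (there (≡.subst (_∈ U) (≡.sym a≡y) (∈-lookup i U)))))) ,
    ≡.trans (agree x (λ p → All≢⇒∉ x∉U (∈-removeAt⁻ i p))) τ′x≡y

  agree-step⁺ : ∀ σ → Agree τ (x ∷ U) σ → lookup σ x ≡ y → Agree τ′ (y ∷ removeAt U i) σ
  agree-step⁺ σ agree e a a∉ with a Fin.≟ x
  ... | yes ≡.refl = ≡.trans e (≡.sym τ′x≡y)
  ... | no a≢x   = ≡.trans
    (agree a λ { (here a≡x) → a≢x a≡x ; (there a∈U) → a∉ (∈-removeAt⁺ i a∈U) })
    (≡.sym (τ′-other a≢x (a∉ ∘ here)))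

-- Finite sums with indicators, and the sum over permutations as a tree

module Sums {c ℓ} (S : CommutativeSemiring c ℓ) where
  open CommutativeSemiring S hiding (zero)
  open Recurrence S
  open Successions S
  open import Algebra.Properties.Semiring.Sum semiring using (sum-replicate-zero)
  open SetoidReasoning setoid

  ∑ₗ : ∀ {A : Set} → List A → (A → Carrier) → Carrier
  ∑ₗ L f = List.foldr _+_ 0# (map f L)

  ∑ₗ-cong : ∀ {A : Set} (L : List A) {f h : A → Carrier} → (∀ {a} → a List.∈ L → f a ≈ h a) → ∑ₗ L f ≈ ∑ₗ L h
  ∑ₗ-cong []      p = refl
  ∑ₗ-cong (a ∷ L) p = +-cong (p (here ≡.refl)) (∑ₗ-cong L (p ∘ there))

  ∑ₗ-0 : ∀ {A : Set} (L : List A) → ∑ₗ L (λ _ → 0#) ≈ 0#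
  ∑ₗ-0 []      = refl
  ∑ₗ-0 (a ∷ L) = trans (+-identityˡ _) (∑ₗ-0 L)

  ∑ₗ-+ : ∀ {A : Set} (L : List A) (f h : A → Carrier) → ∑ₗ L (λ a → f a + h a) ≈ ∑ₗ L f + ∑ₗ L h
  ∑ₗ-+ []      f h = sym (+-identityˡ 0#)
  ∑ₗ-+ (a ∷ L) f h = begin
    f a + h a + ∑ₗ L (λ a → f a + h a)       ≈⟨ +-congˡ (∑ₗ-+ L f h) ⟩
    f a + h a + (∑ₗ L f + ∑ₗ L h)
      ≈⟨ solve 4 (λ x y z w → x :+ y :+ (z :+ w) := x :+ z :+ (y :+ w)) refl (f a) (h a) _ _ ⟩
    f a + ∑ₗ L f + (h a + ∑ₗ L h)            ∎
    where open import Algebra.Solver.Ring.NaturalCoefficients.Default S using (solve; _:+_; _:=_)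

  ∑ₗ-∑ : ∀ {A : Set} (L : List A) n (h : Fin n → A → Carrier) →
    ∑ₗ L (λ a → ∑[ i < n ] h i a) ≈ ∑[ i < n ] ∑ₗ L (h i)
  ∑ₗ-∑ L zero    h = ∑ₗ-0 L
  ∑ₗ-∑ L (suc n) h = trans (∑ₗ-+ L (h zero) (λ a → ∑[ i < n ] h (suc i) a)) (+-congˡ (∑ₗ-∑ L n (h ∘ suc)))

  ∑-0 : ∀ n {h : Fin n → Carrier} → (∀ i → h i ≈ 0#) → ∑[ i < n ] h i ≈ 0#
  ∑-0 n p = trans (sum-cong-≋ p) (sum-replicate-zero n)

  ∑-single : ∀ n (h : Fin n → Carrier) j → (∀ i → i ≢ j → h i ≈ 0#) → ∑[ i < n ] h i ≈ h j
  ∑-single (suc n) h zero    p = trans (+-congˡ (∑-0 n λ i → p (suc i) λ ())) (+-identityʳ _)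
  ∑-single (suc n) h (suc j) p = trans
    (+-cong (p zero λ ()) (∑-single n (h ∘ suc) j λ i i≢j → p (suc i) (i≢j ∘ Fin.suc-injective))) (+-identityˡ _)

  infix 8 ⟦_⟧_

  ⟦_⟧_ : ∀ {P : Set} → Dec P → Carrier → Carrier
  ⟦ d ⟧ a = if does d then a else 0#

  ⟦⟧-yes : ∀ {P : Set} (d : Dec P) → P → ∀ a → ⟦ d ⟧ a ≈ a
  ⟦⟧-yes d p a rewrite dec-true d p = refl

  ⟦⟧-no : ∀ {P : Set} (d : Dec P) → ¬ P → ∀ a → ⟦ d ⟧ a ≈ 0#
  ⟦⟧-no d ¬p a rewrite dec-false d ¬p = refl

  ∑ₗ-unique : ∀ {A : Set} (_≟_ : ∀ a b → Dec (a ≡ b)) {L : List A} {a : A} → List.Unique L → a List.∈ L → ∀ k → ∑ₗ L (λ b → ⟦ b ≟ a ⟧ k) ≈ k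
  ∑ₗ-unique _≟_ {b ∷ L} (b∉ ∷ u) (here ≡.refl) k = trans
    (+-cong (⟦⟧-yes (b ≟ b) ≡.refl k)
      (trans (∑ₗ-cong L λ {b′} b′∈ → ⟦⟧-no (b′ ≟ b) (All.lookup b∉ b′∈ ∘ ≡.sym) k) (∑ₗ-0 L)))
    (+-identityʳ k)
  ∑ₗ-unique _≟_ {b ∷ L} {a} (b∉ ∷ u) (there a∈) k = trans
    (+-cong (⟦⟧-no (b ≟ a) (All.lookup b∉ a∈) k) (∑ₗ-unique _≟_ u a∈ k))
    (+-identityˡ k)

  -- By `value`, σ sends `x` either to `c` or to an entry of `U`. Since `c` is not in `U` and the
  -- entries are distinct, these cases exclude each other, so exactly one indicator on the right is
  -- set when the left one is.
  agree-split : ∀ {n m} (τ : Permutation′ n) c x (U : Vec (Fin n) (suc m)) x∉U τx≡c fixed → Vec.Unique U →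
    ∀ {σ} → σ List.∈ perms n → ∀ a →
    ⟦ Agree? τ (x ∷ U) σ ⟧ a ≈ ⟦ Agree? τ U σ ⟧ a
      + ∑[ i ≤ m ] (⟦ Agree? (Step.τ′ τ c x U x∉U τx≡c fixed i) (lookup U i ∷ removeAt U i) σ ⟧ a)
  agree-split {n} {m} τ c x U x∉U τx≡c fixed unique {σ} σ∈ a = sym (cases (Agree? τ (x ∷ U) σ))
    where
    open State τ c x U x∉U τx≡c fixed
    module St = Step τ c x U x∉U τx≡c fixed
    stays : Dec (Agree τ U σ)
    stays = Agree? τ U σ
    moves : ∀ i → Dec (Agree (St.τ′ i) (lookup U i ∷ removeAt U i) σ)
    moves i = Agree? (St.τ′ i) (lookup U i ∷ removeAt U i) σ
    cases : (d : Dec (Agree τ (x ∷ U) σ)) → ⟦ stays ⟧ a + ∑[ i ≤ m ] (⟦ moves i ⟧ a) ≈ ⟦ d ⟧ a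
    cases (no ¬p) = trans
      (+-cong (⟦⟧-no stays (¬p ∘ proj₁ ∘ agree-close⁻ σ) a)
              (∑-0 (suc m) λ i → ⟦⟧-no (moves i) (¬p ∘ proj₁ ∘ St.agree-step⁻ i σ) a))
      (+-identityʳ 0#)
    cases (yes p) with value {σ} σ∈ p
    ... | inj₁ σx≡c = trans
      (+-cong (⟦⟧-yes stays (agree-close⁺ σ p σx≡c) a)
              (∑-0 (suc m) λ i → ⟦⟧-no (moves i)
                (λ q → VAll.lookup⁺ c∉U i (≡.trans (≡.sym σx≡c) (proj₂ (St.agree-step⁻ i σ q)))) a))
      (+-identityʳ a)
    ... | inj₂ (j , σx≡y) = trans
      (+-cong (⟦⟧-no stays (λ q → VAll.lookup⁺ c∉U j (≡.trans (≡.sym (proj₂ (agree-close⁻ σ q))) σx≡y)) a)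
              (trans
                (∑-single (suc m) (λ i → ⟦ moves i ⟧ a) j λ i i≢j → ⟦⟧-no (moves i)
                  (λ q → i≢j (VUnique.lookup-injective unique i j (≡.trans (≡.sym (proj₂ (St.agree-step⁻ i σ q))) σx≡y))) a)
                (⟦⟧-yes (moves j) (St.agree-step⁺ j σ p σx≡y) a)))
      (+-identityˡ a)

  -- The permutations are uncovered one value at a time along their cycles: those agreeing with τ outside
  -- x ∷ U still have the value at x, the last letter so far of a cycle begun at c, and those on U free.
  ∑-agree : ∀ {n} m (τ : Permutation′ n) c x (U : Vec (Fin n) m) (f : Word n → Carrier) (φ : List (Fin n) → Carrier) →
    VAll.All (x ≢_) U → Vec.Unique U → τ ⟨$⟩ʳ x ≡ c → VAll.All (λ u → τ ⟨$⟩ʳ u ≡ u) U →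
    (∀ {σ} → Agree τ (x ∷ U) σ → ∀ {u} → Runs σ c x U u → f σ ≈ φ u) →
    ∑ₗ (perms n) (λ σ → ⟦ Agree? τ (x ∷ U) σ ⟧ f σ) ≈ E m U φ
  -- With no letters left, injectivity forces σ(x) = c, so `τ` itself is the only permutation
  -- counted.
  ∑-agree {n} zero τ c x [] f φ x∉U unique τx≡c fixed hyp = trans
    (∑ₗ-cong (perms n) λ {σ} σ∈ → pointwise σ∈ (Agree? τ (x ∷ []) σ))
    (∑ₗ-unique (Vec.≡-dec Fin._≟_) (perms-unique n) (∈-perms (VUnique.tabulate⁺ (⟨$⟩ʳ-injective τ))) (φ []))
    where
    open State τ c x [] x∉U τx≡c fixed
    τᵛ : Word n
    τᵛ = tabulate (τ ⟨$⟩ʳ_)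
    pointwise : ∀ {σ} → σ List.∈ perms n → (d : Dec (Agree τ (x ∷ []) σ)) → ⟦ d ⟧ f σ ≈ ⟦ Vec.≡-dec Fin._≟_ σ τᵛ ⟧ φ []
    pointwise {σ} σ∈ (no ¬p) = sym (⟦⟧-no (Vec.≡-dec Fin._≟_ σ τᵛ)
      (λ { ≡.refl → ¬p λ a _ → Vec.lookup∘tabulate (τ ⟨$⟩ʳ_) a }) (φ []))
    pointwise {σ} σ∈ (yes p) with value {σ} σ∈ p
    ... | inj₁ σx≡c = trans (hyp {σ} p (done σx≡c)) (sym (⟦⟧-yes (Vec.≡-dec Fin._≟_ σ τᵛ)
      (≡.trans (≡.sym (Vec.tabulate∘lookup σ)) (Vec.tabulate-cong λ a → agree-close⁺ σ p σx≡c a λ ())) (φ [])))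
  ∑-agree {n} (suc m) τ c x U@(h ∷ t) f φ x∉U unique@(h∉t ∷ t-unique) τx≡c fixed@(τh≡h ∷ t-fixed) hyp = begin
    ∑ₗ (perms n) (λ σ → ⟦ Agree? τ (x ∷ U) σ ⟧ f σ)
      ≈⟨ ∑ₗ-cong (perms n) (λ {σ} σ∈ → agree-split τ c x U x∉U τx≡c fixed unique σ∈ (f σ)) ⟩
    ∑ₗ (perms n) (λ σ → stays σ + ∑[ i ≤ m ] moves i σ)
      ≈⟨ trans (∑ₗ-+ (perms n) stays (λ σ → ∑[ i ≤ m ] moves i σ)) (+-congˡ (∑ₗ-∑ (perms n) (suc m) moves)) ⟩
    ∑ₗ (perms n) stays + ∑[ i ≤ m ] ∑ₗ (perms n) (moves i)
      -- If the cycle closes, `τ` stays as it is: it already sends `x` to `c` and fixes `h`, which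
      -- opens the next cycle. This branch is the additional `pick zero` of `E`.
      ≈⟨ +-cong
           (∑-agree m τ h h t f (φ ∘ (h ∷_)) h∉t t-unique τh≡h t-fixed
             (λ {σ} agree r → hyp {σ} (proj₁ (agree-close⁻ σ agree)) (close (proj₂ (agree-close⁻ σ agree)) r)))
           (sum-cong-≋ {suc m} λ i →
             ∑-agree m (St.τ′ i) c (lookup U i) (removeAt U i) f (φ ∘ (lookup U i ∷_))
               (proj₁ (unique-removeAt unique i)) (proj₂ (unique-removeAt unique i)) (St.τ′y≡c i) (St.fixed′ i unique)
               (λ {σ} agree r → hyp {σ} (proj₁ (St.agree-step⁻ i σ agree)) (step i (proj₂ (St.agree-step⁻ i σ agree)) r))) ⟩
    E (suc m) U φ ∎
    where
    open State τ c x U x∉U τx≡c fixed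
    module St = Step τ c x U x∉U τx≡c fixed
    stays : Word n → Carrier
    stays σ = ⟦ Agree? τ U σ ⟧ f σ
    moves : Fin (suc m) → Word n → Carrier
    moves i σ = ⟦ Agree? (St.τ′ i) (lookup U i ∷ removeAt U i) σ ⟧ f σ

  -- At the root the letter 0 opens the first cycle and every value is undecided, so agreement with
  -- the identity holds vacuously.
  ∑-perms : ∀ t (φ : List ℕ → Carrier) →
    ∑ₗ (perms (suc t)) (φ ∘ flatten) ≈ E t (tabulate suc) (λ u → φ (map toℕ (zero {t} ∷ u)))
  ∑-perms t φ = trans
    (∑ₗ-cong (perms (suc t)) λ {σ} _ → sym (⟦⟧-yes (Agree? Perm.id (zero ∷ tabulate suc) σ)
      (λ a a∉ → contradiction (all a) a∉) (φ (flatten σ))))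
    (∑-agree t Perm.id zero zero (tabulate suc) (φ ∘ flatten) _
      (VAll.tabulate⁺ {f = suc} λ i ()) (VUnique.tabulate⁺ Fin.suc-injective) ≡.refl (VAll.tabulate⁺ {f = suc} λ _ → ≡.refl)
      (λ {σ} _ r → reflexive (cong φ (flatten-runs σ r))))
    where
    all : ∀ a → a ∈ zero ∷ tabulate suc
    all zero    = here ≡.refl
    all (suc a) = there (≡.subst (_∈ tabulate suc) (Vec.lookup∘tabulate suc a) (∈-lookup a (tabulate suc)))

-- The coefficients b and the theorem

module P = CommutativeSemiring polySemiring
module R = Recurrence polySemiring
open R using (_·_; Σ<)

q≈1+qm1 : qP ≋ (1P +P qm1)
q≈1+qm1 = coeffwise λ where
  0             → ≡.refl
  1             → ≡.refl
  (suc (suc i)) → ≡.refl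

^P≡^ : ∀ p k → p ^P k ≡ p R.^ k
^P≡^ p zero    = ≡.refl
^P≡^ p (suc k) = cong (p *P_) (^P≡^ p k)

-- Integrality of the coefficients of b

toℚᵘ-/ : ∀ z d → ℚ.toℚᵘ (z / suc d) ≃ mkℚᵘ z d
toℚᵘ-/ z d = ℚ.toℚᵘ-fromℚᵘ (mkℚᵘ z d)

suc/1 : ∀ n → + suc n / 1 ≡ 1ℚ ℚ.+ + n / 1
suc/1 n = ℚ.toℚᵘ-injective (begin
  ℚ.toℚᵘ (+ suc n / 1)            ≈⟨ toℚᵘ-/ (+ suc n) 0 ⟩
  mkℚᵘ (+ suc n) 0                ≈⟨ *≡* (cong (ℤ._* + 1) (cong (ℤ._+_ (+ 1)) (≡.sym (ℤ.*-identityʳ (+ n))))) ⟩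
  ℚ.toℚᵘ 1ℚ ℚᵘ.+ mkℚᵘ (+ n) 0     ≈⟨ ℚᵘ.+-congʳ (ℚ.toℚᵘ 1ℚ) (toℚᵘ-/ (+ n) 0) ⟨
  ℚ.toℚᵘ 1ℚ ℚᵘ.+ ℚ.toℚᵘ (+ n / 1) ≈⟨ ℚ.toℚᵘ-homo-+ 1ℚ (+ n / 1) ⟨
  ℚ.toℚᵘ (1ℚ ℚ.+ + n / 1)         ∎)
  where open ℚᵘ.≃-Reasoning

/-* : ∀ a k c e → a ℕ.* c ≡ suc k ℕ.* e → (+ a / suc k) ℚ.* (+ c / 1) ≡ + e / 1
/-* a k c e eq = ℚ.toℚᵘ-injective (begin
  ℚ.toℚᵘ ((+ a / suc k) ℚ.* (+ c / 1))       ≈⟨ ℚ.toℚᵘ-homo-* (+ a / suc k) (+ c / 1) ⟩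
  ℚ.toℚᵘ (+ a / suc k) ℚᵘ.* ℚ.toℚᵘ (+ c / 1) ≈⟨ ℚᵘ.*-cong (toℚᵘ-/ (+ a) k) (toℚᵘ-/ (+ c) 0) ⟩
  mkℚᵘ (+ a) k ℚᵘ.* mkℚᵘ (+ c) 0             ≈⟨ *≡* cross ⟩
  mkℚᵘ (+ e) 0                               ≈⟨ toℚᵘ-/ (+ e) 0 ⟨
  ℚ.toℚᵘ (+ e / 1)                           ∎)
  where
  cross : + a ℤ.* + c ℤ.* + 1 ≡ + e ℤ.* (+ suc k ℤ.* + 1)
  cross = ≡.trans (ℤ.*-identityʳ _) (≡.trans (≡.sym (ℤ.pos-* a c)) (≡.trans (cong +_ eq)
          (≡.trans (ℤ.pos-* (suc k) e) (≡.trans (ℤ.*-comm (+ suc k) (+ e)) (cong (+ e ℤ.*_) (≡.sym (ℤ.*-identityʳ (+ suc k))))))))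
  open ℚᵘ.≃-Reasoning

coeff-·ℕ : ∀ n p i → coeff (n · p) i ≡ (+ n / 1) ℚ.* coeff p i
coeff-·ℕ zero    p i = ≡.sym (ℚ.*-zeroˡ (coeff p i))
coeff-·ℕ (suc n) p i = begin
  coeff (p +P n · p) i                         ≡⟨ coeff-+ p (n · p) i ⟩
  coeff p i ℚ.+ coeff (n · p) i                ≡⟨ cong₂ ℚ._+_ (≡.sym (ℚ.*-identityˡ (coeff p i))) (coeff-·ℕ n p i) ⟩
  1ℚ ℚ.* coeff p i ℚ.+ (+ n / 1) ℚ.* coeff p i ≡⟨ ℚ.*-distribʳ-+ (coeff p i) 1ℚ (+ n / 1) ⟨
  (1ℚ ℚ.+ + n / 1) ℚ.* coeff p i               ≡⟨ cong (ℚ._* coeff p i) (suc/1 n) ⟨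
  (+ suc n / 1) ℚ.* coeff p i                  ∎
  where open ≡.≡-Reasoning

m+n⊖n : ∀ m n → (m ℕ.+ n) ⊖ n ≡ + m
m+n⊖n m n = ≡.trans (ℤ.m-n≡m⊖n (m ℕ.+ n) n) (≡.trans (ℤ.⊖-≥ (ℕ.m≤n+m n m)) (cong +_ (ℕ.m+n∸n≡m m n)))

-- At k = 0 the lower index is -1, and the convention is evaluated: C(-1,-1) = 1, and C(i-1,-1) = 0
-- for i > 0.
binomℤ-multichoose : ∀ k i → binomℤ ((suc k ℕ.+ i) ⊖ 2) (suc k ⊖ 2) ≡ multichoose k i
binomℤ-multichoose zero    zero    = ≡.refl
binomℤ-multichoose zero    (suc i) = ≡.refl
binomℤ-multichoose (suc k) i       = ≡.refl

binomℤ-paths : ∀ k i e → binomℤ (suc (suc (k ℕ.+ (i ℕ.+ e))) ⊖ (2 ℕ.+ i)) (suc k ⊖ 1) ≡ paths k e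
binomℤ-paths k i e = cong (λ z → binomℤ z (+ k)) (≡.trans (cong (_⊖ (2 ℕ.+ i)) (eq k i e)) (m+n⊖n (k ℕ.+ e) (2 ℕ.+ i)))
  where
  eq : ∀ k i e → suc (suc (k ℕ.+ (i ℕ.+ e))) ≡ k ℕ.+ e ℕ.+ (2 ℕ.+ i)
  eq = ℕSolver.solve-∀

numerator : ∀ k i e → (suc (k ℕ.+ (i ℕ.+ e)) ℕ.+ suc k) ⊖ i ≡ + (suc k ℕ.+ e ℕ.+ suc k)
numerator k i e = ≡.trans (cong (_⊖ i) (eq k i e)) (m+n⊖n (suc k ℕ.+ e ℕ.+ suc k) i)
  where
  eq : ∀ k i e → suc (k ℕ.+ (i ℕ.+ e)) ℕ.+ suc k ≡ suc k ℕ.+ e ℕ.+ suc k ℕ.+ i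
  eq = ℕSolver.solve-∀

-- Here j = k+1 and n = k+i+e+2; with the slack `e` as a parameter, the numerator and the second
-- binomial need no subtraction. The quotient is integral because n-1+j-i = (k+1+e) + (k+1), and
-- (k+1+e) C(k+e,k) = (k+1) C(k+1+e,k+1) by absorption.
b-summand : ∀ k i e → let m = k ℕ.+ (i ℕ.+ e) in
  ((((suc m ℕ.+ suc k) ⊖ i) / suc k) ·P
    (((+ (binomℤ ((suc k ℕ.+ i) ⊖ 2) (suc k ⊖ 2) ℕ.* binomℤ (suc (suc m) ⊖ (2 ℕ.+ i)) (suc k ⊖ 1))) / 1) ·P qpow i))
  ≈P (multichoose k i ℕ.* (paths k e ℕ.+ paths (suc k) e)) · qP R.^ i
b-summand k i e j rewrite binomℤ-multichoose k i | binomℤ-paths k i e | numerator k i e = begin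
  coeff ((+ a / suc k) ·P ((+ c / 1) ·P qpow i)) j   ≡⟨ coeff-· (+ a / suc k) ((+ c / 1) ·P qpow i) j ⟩
  (+ a / suc k) ℚ.* coeff ((+ c / 1) ·P qpow i) j    ≡⟨ cong ((+ a / suc k) ℚ.*_) (coeff-· (+ c / 1) (qpow i) j) ⟩
  (+ a / suc k) ℚ.* ((+ c / 1) ℚ.* coeff (qpow i) j) ≡⟨ ℚ.*-assoc (+ a / suc k) (+ c / 1) _ ⟨
  (+ a / suc k) ℚ.* (+ c / 1) ℚ.* coeff (qpow i) j   ≡⟨ cong (ℚ._* coeff (qpow i) j) (/-* a k c t scaled) ⟩
  (+ t / 1) ℚ.* coeff (qpow i) j                     ≡⟨ cong (λ p → (+ t / 1) ℚ.* coeff p j) (^P≡^ qP i) ⟩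
  (+ t / 1) ℚ.* coeff (qP R.^ i) j                   ≡⟨ coeff-·ℕ t (qP R.^ i) j ⟨
  coeff (t · qP R.^ i) j                             ∎
  where
  open ≡.≡-Reasoning
  a = suc k ℕ.+ e ℕ.+ suc k
  c = multichoose k i ℕ.* paths k e
  t = multichoose k i ℕ.* (paths k e ℕ.+ paths (suc k) e)
  scaled : a ℕ.* c ≡ suc k ℕ.* t
  scaled = begin
    (suc k ℕ.+ e ℕ.+ suc k) ℕ.* (multichoose k i ℕ.* paths k e)
      ≡⟨ expand (multichoose k i) (suc k ℕ.+ e) (suc k) (paths k e) ⟩
    multichoose k i ℕ.* ((suc k ℕ.+ e) ℕ.* paths k e ℕ.+ suc k ℕ.* paths k e)
      ≡⟨ cong (λ x → multichoose k i ℕ.* (x ℕ.+ suc k ℕ.* paths k e)) (paths-absorbˡ k e) ⟩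
    multichoose k i ℕ.* (suc k ℕ.* paths (suc k) e ℕ.+ suc k ℕ.* paths k e)
      ≡⟨ collect (multichoose k i) (suc k) (paths k e) (paths (suc k) e) ⟩
    suc k ℕ.* (multichoose k i ℕ.* (paths k e ℕ.+ paths (suc k) e)) ∎
    where
    expand : ∀ z x y w → (x ℕ.+ y) ℕ.* (z ℕ.* w) ≡ z ℕ.* (x ℕ.* w ℕ.+ y ℕ.* w)
    expand = ℕSolver.solve-∀
    collect : ∀ z x y w → z ℕ.* (x ℕ.* w ℕ.+ x ℕ.* y) ≡ x ℕ.* (z ℕ.* (y ℕ.+ w))
    collect = ℕSolver.solve-∀

module _ where
  open R

  f : ℕ → Poly
  f m = F qP qm1 q≈1+qm1 m 0

  b-explicit : ∀ m k → k ≤ m → b (suc (suc m)) k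
    ≋ Σ< (λ i → coefficient k (m ∸ k) i · qP ^ i) (suc (m ∸ k))
  b-explicit m k k≤m = P.trans (P.reflexive (cong sumP (map-upTo summand (suc (m ∸ k)))))
    (Σ<-cong (suc (m ∸ k)) {summand} {λ i → coefficient k (m ∸ k) i · qP ^ i} pointwise)
    where
    summand : ℕ → Poly
    summand i = (((suc m ℕ.+ suc k) ⊖ i) / suc k) ·P
        (((+ (binomℤ ((suc k ℕ.+ i) ⊖ 2) (suc k ⊖ 2) ℕ.* binomℤ (suc (suc m) ⊖ (2 ℕ.+ i)) (suc k ⊖ 1))) / 1) ·P qpow i)
    pointwise : ∀ i → i ℕ.< suc (m ∸ k) →
      summand i ≋ coefficient k (m ∸ k) i · qP ^ i
    -- `m` has to be replaced by `k + (i + e)` with e = m-k-i, the form in which `b-summand` is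
    -- stated.
    pointwise i (s≤s i≤d) = ≡.subst (λ m′ →
      ((((suc m′ ℕ.+ suc k) ⊖ i) / suc k) ·P
        (((+ (binomℤ ((suc k ℕ.+ i) ⊖ 2) (suc k ⊖ 2) ℕ.* binomℤ (suc (suc m′) ⊖ (2 ℕ.+ i)) (suc k ⊖ 1))) / 1) ·P qpow i))
      ≋ coefficient k (m ∸ k) i · qP ^ i)
      (≡.trans (cong (k ℕ.+_) (ℕ.m+[n∸m]≡n i≤d)) (ℕ.m+[n∸m]≡n k≤m))
      (coeffwise (b-summand k i (m ∸ k ∸ i)))

  recurrence : (∀ m → g (suc m) ≋ f m) → ∀ m → g (suc (suc m)) ≋ rhs (suc (suc m))
  recurrence g≈f m = begin
    g (suc (suc m)) ≈⟨ g≈f (suc m) ⟩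
    f (suc m)       ≈⟨ F-recurrence qP qm1 q≈1+qm1 m ⟩
    Σ< (λ k → Σ< (λ i → coefficient k (m ∸ k) i · qP ^ i) (suc (m ∸ k)) *P qm1 ^ k *P f (m ∸ k)) (suc m)
      ≈⟨ Σ<-cong (suc m) pointwise ⟨
    Σ< (λ k → b (suc (suc m)) k *P (qm1 ^P k) *P g (suc (suc m) ∸ suc k)) (suc m)
      ≡⟨ cong sumP (map-upTo (λ k → b (suc (suc m)) k *P (qm1 ^P k) *P g (suc (suc m) ∸ suc k)) (suc m)) ⟨
    rhs (suc (suc m)) ∎
    where
    open SetoidReasoning P.setoid
    pointwise : ∀ k → k ℕ.< suc m →
      b (suc (suc m)) k *P (qm1 ^P k) *P g (suc (suc m) ∸ suc k)
      ≋ Σ< (λ i → coefficient k (m ∸ k) i · qP ^ i) (suc (m ∸ k)) *P qm1 ^ k *P f (m ∸ k)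
    pointwise k (s≤s k≤m) = P.*-cong
      (P.*-cong (b-explicit m k k≤m) (P.reflexive (^P≡^ qm1 k)))
      (P.trans (P.reflexive (cong g (ℕ.+-∸-assoc 1 k≤m))) (g≈f (m ∸ k)))

  -- The word starts with 0 and all remaining letters lie above it, whence the rank 0 in `f`.
  g≈f : ∀ m → g (suc m) ≋ f m
  g≈f m = begin
    g (suc m)                                                          ≈⟨ ∑-perms m (qpow ∘ occ13-2) ⟩
    E m (tabulate suc) (λ u → qpow (occ13-2 (map toℕ (zero {m} ∷ u))))
      ≈⟨ E-cong m (tabulate suc) (λ {u} _ → P.reflexive (^P≡^ qP (occ13-2 (map toℕ (zero {m} ∷ u))))) ⟩
    E m (tabulate suc) (λ u → qP ^ occ13-2 (map toℕ (zero {m} ∷ u)))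
      ≈⟨ E-occ qP qm1 q≈1+qm1 m (tabulate suc) zero 0 (tabulate-sorted suc s≤s) (above (VAll.tabulate⁺ {f = suc} λ _ → ℕ.z<s)) ⟩
    f m ∎
    where
    open SetoidReasoning P.setoid
    open Successions polySemiring
    open Sums polySemiring

theorem2p2 : (n : ℕ) → 2 ≤ n → g n ≈P rhs n
theorem2p2 (suc (suc m)) 2≤n = _≋_.coeffs (recurrence g≈f m)
theorem2p2 1 (s≤s ())
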